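{- Let $k\geq 3$, let $n$ be a positive odd integer, and let $G_1=P_1\times\cdots\times P_m$ ($m\geq 1$) be a finite nilpotent group of odd order whose Sylow subgroups $P_1,\dots,P_m$ (for the distinct prime divisors $p_1,\dots,p_m$ of $|G_1|$) are not cyclic. Let $r_i$ be the number of distinct subgroups of order $p_i$ in $P_i$, indexed so that $r_1\leq r_2\leq\cdots\leq r_m$. (a) If $G=Q_{2^k}$ or $G=\mathbb{Z}_n\times Q_{2^k}$, then $\gamma(\mathcal{G}_E^{**}(G))=2^{k-2}+1$. (b) If $G=G_1\times Q_{2^k}$, or $G=G_1\times\mathbb{Z}_n\times Q_{2^k}$ with $\gcd(|G_1|,n)=1$, then $\gamma(\mathcal{G}_E^{**}(G))=\min\{r_1,\,2^{k-2}+1\}$.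
   Context: $\mathbb{Z}_n$ denotes the cyclic group of order $n$. The generalized quaternion group $Q_{2^k}$ ($k\geq 3$) is the group of order $2^k$ generated by $x,y$ with $x^{2^{k-1}}=1$, $x^{2^{k-2}}=y^2$ and $yxy^{ -1}=x^{ -1}$. The enhanced power graph $\mathcal{G}_E(G)$ of a group $G$ is the simple graph with vertex set $G$ in which two distinct vertices $u,v$ are adjacent if and only if there is $w\in G$ with $u\in\langle w\rangle$ and $v\in\langle w\rangle$. A dominating vertex of a graph is a vertex adjacent to every other vertex. The proper enhanced power graph $\mathcal{G}_E^{**}(G)$ is the graph obtained from $\mathcal{G}_E(G)$ by deleting all of its dominating vertices (including the identity). A dominating set of a graph $\Gamma=(V,E)$ is a set $D\subseteq V$ such that every vertex of $V\setminus D$ is adjacent to some vertex of $D$. The domination number $\gamma(\Gamma)$ is the minimum cardinality of a dominating set of $\Gamma$. -}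

module Defs where

open import Algebra.Bundles using (Group)
import Algebra.Definitions.RawMonoid as RawMonoidDefs
open import Data.Fin using (Fin)
import Data.Fin.Properties as Fin
open import Data.Integer using (ℤ; +_; -[1+_])
open import Data.List using (List; length)
open import Data.List.Relation.Unary.Any using (Any)
import Data.List.Membership.Setoid as Membership
import Data.List.Relation.Unary.Unique.Setoid as UniqueSetoid
open import Data.Nat using (ℕ; zero; suc; _^_; _∸_; _≤_)
open import Data.Nat.Divisibility using (_∣_)
open import Data.Nat.Primality using (Prime)
open import Data.Product using (Σ; ∃; _×_; _,_; proj₁; proj₂)
open import Data.Sum using (_⊎_)
open import Function.Base using (_∘_)
open import Function.Bundles using (Inverse; _⇔_)
open import Function.Definitions using (Injective)
open import Level using (Level; _⊔_) renaming (suc to lsuc)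
open import Relation.Binary.Bundles using (Setoid)
open import Relation.Binary.Definitions using (Symmetric; _Respects₂_)
import Relation.Binary.Construct.On as On
open import Relation.Binary.PropositionalEquality using (_≡_)
open import Relation.Nullary using (¬_)
open import Relation.Unary using (Pred; _∈_; _≐_)
open import Relation.Unary.Relation.Binary.Equality using (≐-setoid)

private
  variable
    a c ℓ e p : Level

HasCardinality : Setoid c ℓ → ℕ → Set (c ⊔ ℓ)
HasCardinality S n = Inverse S (Fin.≡-setoid n)

subsetoid : (S : Setoid c ℓ) → Pred (Setoid.Carrier S) p → Setoid (c ⊔ p) ℓ
subsetoid S P = On.setoid S (proj₁ {B = P})

------------------------------------------------------------------------
-- Simple graphs

record SimpleGraph c ℓ e : Set (lsuc (c ⊔ ℓ ⊔ e)) where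
  infix 4 _~_
  field
    vertices : Setoid c ℓ
  open Setoid vertices public using (_≈_) renaming (Carrier to Vertex)
  field
    _~_    : Vertex → Vertex → Set e
    ~-resp : _~_ Respects₂ _≈_
    ~-sym  : Symmetric _~_
    irrefl : ∀ {u v} → u ≈ v → ¬ u ~ v

module _ (Γ : SimpleGraph c ℓ e) where
  open SimpleGraph Γ
  open Membership vertices using (_∉_)
  open UniqueSetoid vertices using (Unique)

  IsDominatingVertex : Pred Vertex (c ⊔ ℓ ⊔ e)
  IsDominatingVertex u = ∀ v → ¬ u ≈ v → u ~ v

  inducedSubgraph : Pred Vertex p → SimpleGraph (c ⊔ p) ℓ e
  inducedSubgraph P = record
    { vertices = subsetoid vertices P
    ; _~_      = λ u v → proj₁ u ~ proj₁ v
    ; ~-resp   = (λ v≈w → proj₁ ~-resp v≈w) , (λ v≈w → proj₂ ~-resp v≈w)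
    ; ~-sym    = ~-sym
    ; irrefl   = irrefl
    }

  -- Finite sets of vertices are given as lists without repetitions, so that
  -- their cardinality is the length of the list.
  IsDominatingSet : Pred (List Vertex) (c ⊔ ℓ ⊔ e)
  IsDominatingSet D = Unique D × (∀ v → v ∉ D → Any (v ~_) D)

  record IsDominationNumber (γ : ℕ) : Set (c ⊔ ℓ ⊔ e) where
    field
      attained : ∃ λ D → IsDominatingSet D × length D ≡ γ
      minimal  : ∀ D → IsDominatingSet D → γ ≤ length D

------------------------------------------------------------------------
-- Groups

module _ (G : Group c ℓ) where
  open Group G renaming (_⁻¹ to infix 8 _⁻¹)
  open RawMonoidDefs rawMonoid using () renaming (_×_ to _times_)

  HasOrder : ℕ → Set (c ⊔ ℓ)
  HasOrder = HasCardinality setoid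

  power : Carrier → ℤ → Carrier
  power w (+ n)    = n times w
  power w -[1+ n ] = (suc n times w) ⁻¹

  ⟨_⟩ : Carrier → Pred Carrier ℓ
  ⟨ w ⟩ u = ∃ λ z → u ≈ power w z

  IsCyclic : Set (c ⊔ ℓ)
  IsCyclic = ∃ λ w → ∀ u → u ∈ ⟨ w ⟩

  data Generated (S : Pred Carrier p) : Pred Carrier (c ⊔ ℓ ⊔ p) where
    gen  : ∀ {g} → g ∈ S → g ∈ Generated S
    unit : ε ∈ Generated S
    mul  : ∀ {g h} → g ∈ Generated S → h ∈ Generated S → g ∙ h ∈ Generated S
    inv  : ∀ {g} → g ∈ Generated S → g ⁻¹ ∈ Generated S
    resp : ∀ {g h} → g ≈ h → g ∈ Generated S → h ∈ Generated S

  record IsGeneralizedQuaternion (k : ℕ) : Set (c ⊔ ℓ) where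
    field
      order        : HasOrder (2 ^ k)
      x y          : Carrier
      generated    : ∀ g → g ∈ Generated (λ s → s ≈ x ⊎ s ≈ y)
      x-order      : (2 ^ (k ∸ 1)) times x ≈ ε
      x-half-order : (2 ^ (k ∸ 2)) times x ≈ 2 times y
      conjugation  : (y ∙ x) ∙ y ⁻¹ ≈ x ⁻¹

  upperCentral : ℕ → Pred Carrier (c ⊔ ℓ)
  upperCentral zero    g = Level.Lift c (g ≈ ε)
  upperCentral (suc i) g = ∀ h → ((g ∙ h) ∙ g ⁻¹) ∙ h ⁻¹ ∈ upperCentral i

  IsNilpotent : Set (c ⊔ ℓ)
  IsNilpotent = ∃ λ i → ∀ g → g ∈ upperCentral i

  -- The level ℓ of the membership predicate is enough for every subgroup of
  -- a finite group, as g ∈ H can be read as "g ≈ some listed element of H".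
  record Subgroup : Set (c ⊔ lsuc ℓ) where
    field
      member    : Pred Carrier ℓ
      respects  : ∀ {g h} → g ≈ h → g ∈ member → h ∈ member
      ε-closed  : ε ∈ member
      ∙-closed  : ∀ {g h} → g ∈ member → h ∈ member → g ∙ h ∈ member
      ⁻¹-closed : ∀ {g} → g ∈ member → g ⁻¹ ∈ member

  -- Two subgroups are equal when they have the same elements.
  subgroupsOfOrder : ℕ → Setoid (c ⊔ lsuc ℓ) (c ⊔ ℓ)
  subgroupsOfOrder n = On.setoid (≐-setoid Carrier ℓ)
    (λ (H : Σ Subgroup λ H → HasCardinality (subsetoid setoid (Subgroup.member H)) n) →
      Subgroup.member (proj₁ H))

  enhancedPowerGraph : SimpleGraph c ℓ (c ⊔ ℓ)
  enhancedPowerGraph = record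
    { vertices = setoid
    ; _~_      = λ u v → ¬ u ≈ v × ∃ λ w → u ∈ ⟨ w ⟩ × v ∈ ⟨ w ⟩
    ; ~-resp   =
        (λ v≈v′ (u≉v , w , u∈ , z , v≈) →
          (λ u≈v′ → u≉v (trans u≈v′ (sym v≈v′))) , w , u∈ , z , trans (sym v≈v′) v≈)
      , (λ u≈u′ (u≉v , w , (z , u≈) , v∈) →
          (λ u′≈v → u≉v (trans u≈u′ u′≈v)) , w , (z , trans (sym u≈u′) u≈) , v∈)
    ; ~-sym    = λ (u≉v , w , u∈ , v∈) → (u≉v ∘ sym) , w , v∈ , u∈
    ; irrefl   = λ u≈v (u≉v , _) → u≉v u≈v
    }

  properEnhancedPowerGraph : SimpleGraph (c ⊔ ℓ) ℓ (c ⊔ ℓ)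
  properEnhancedPowerGraph = inducedSubgraph enhancedPowerGraph
    (λ u → ¬ IsDominatingVertex enhancedPowerGraph u)

∏ : {I : Set a} → (I → Group c ℓ) → Group (a ⊔ c) (a ⊔ ℓ)
∏ P = record
  { Carrier = ∀ i → Carrier (P i)
  ; _≈_     = λ g h → ∀ i → _≈_ (P i) (g i) (h i)
  ; _∙_     = λ g h i → _∙_ (P i) (g i) (h i)
  ; ε       = λ i → ε (P i)
  ; _⁻¹     = λ g i → _⁻¹ (P i) (g i)
  ; isGroup = record
    { isMonoid = record
      { isSemigroup = record
        { isMagma = record
          { isEquivalence = record
            { refl  = λ i → refl (P i)
            ; sym   = λ eq i → sym (P i) (eq i)
            ; trans = λ eq₁ eq₂ i → trans (P i) (eq₁ i) (eq₂ i)
            }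
          ; ∙-cong = λ eq₁ eq₂ i → ∙-cong (P i) (eq₁ i) (eq₂ i)
          }
        ; assoc = λ f g h i → assoc (P i) (f i) (g i) (h i)
        }
      ; identity = (λ g i → identityˡ (P i) (g i)) , (λ g i → identityʳ (P i) (g i))
      }
    ; inverse = (λ g i → inverseˡ (P i) (g i)) , (λ g i → inverseʳ (P i) (g i))
    ; ⁻¹-cong = λ eq i → ⁻¹-cong (P i) (eq i)
    }
  }
  where open Group

-- For a group ∏ P of order N: the p i are the distinct prime divisors of N,
-- and each factor P i has the order of a Sylow (p i)-subgroup of ∏ P.
record AreSylowFactors {m} (p : Fin m → ℕ) (P : Fin m → Group c ℓ) (N : ℕ) : Set (c ⊔ ℓ) where
  field
    distinct      : Injective _≡_ _≡_ p
    primeDivisors : ∀ q → (Prime q × q ∣ N) ⇔ (∃ λ i → p i ≡ q)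
    sylow         : ∀ i → ∃ λ k → HasOrder (P i) (p i ^ k) × ¬ (p i ^ suc k ∣ N)

{-# OPTIONS --safe #-}
-- In Q = Q_{2^k}, a cyclic subgroup containing an element outside the centre
-- ⟨ z ⟩ lies in exactly one of ⟨ x ⟩ and the 2^(k−2) subgroups ⟨ xⁱ y ⟩ of order
-- 4; in a noncyclic pᵢ-group Pᵢ, a nontrivial element determines the unique
-- subgroup of order pᵢ among its powers. Either way the noncentral elements are
-- labelled so that a representative of one label is never joined (in a common
-- cyclic subgroup) to an element with another label.
--
-- In a product of groups of coprime exponents, two elements are joined iff their
-- components are. One representative per label of a single factor is therefore a
-- dominating set, while a set smaller than all the numbers of labels misses a
-- label in every factor, and an element carrying all the missed labels is joined
-- to no vertex of that set.
--
-- The representatives in Pᵢ have to be nondominating, i.e. Pᵢ needs two subgroups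
-- of order p. Take g whose order p^(e+1) is the exponent and y ∉ ⟨ g ⟩ normalizing
-- ⟨ g ⟩ with yᵖ ∈ ⟨ g ⟩. Then y g y⁻¹ = gˢ with s ≡ 1 modulo p by nilpotency, and as
-- p is odd some gᵇ y has order p.
module Submission where

open import Defs
open import Algebra.Bundles using (Group)
open import Algebra.Construct.DirectProduct using (group)
import Algebra.Properties.Group as GroupProperties
import Algebra.Properties.Monoid.Mult as Mult
open import Data.Fin as Fin using (Fin; zero; suc; toℕ; fromℕ<; splitAt; _↑ˡ_; _↑ʳ_)
import Data.Fin.Properties as Fin
import Data.Integer as ℤ
open import Data.List using (List; []; _∷_; length; lookup; tabulate)
open import Data.List.Properties using (length-tabulate)
import Data.List.Membership.Setoid as Membership
import Data.List.Membership.Setoid.Properties as ∈ₚ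
open import Data.List.Relation.Unary.All as All using ([]; _∷_)
open import Data.List.Relation.Unary.AllPairs using ([]; _∷_)
open import Data.List.Relation.Unary.Any as Any using (here; there)
import Data.List.Relation.Unary.Any.Properties as Any
import Data.List.Relation.Unary.Unique.Setoid as UniqueSetoid
import Data.List.Relation.Unary.Unique.Setoid.Properties as Unique
open import Data.Nat hiding (_≟_; _⊔_)
open import Data.Nat.Coprimality as Coprimality
  using (Coprime; coprime-Bézout; coprime-divisor; gcd≡1⇒coprime)
open import Data.Nat.Divisibility
open import Data.Nat.DivMod
open import Data.Nat.GCD using (gcd; module Bézout)
open import Data.Nat.Primality
  using (Prime; euclidsLemma; prime[2]; prime⇒irreducible; prime⇒nonTrivial; prime⇒nonZero)
open import Data.Nat.Properties hiding (_≟_)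
open import Data.Nat.Tactic.RingSolver using (solve-∀)
open import Data.Product using (∃; ∃₂; _×_; _,_; proj₁; proj₂)
open import Data.Product.Relation.Binary.Pointwise.NonDependent using (×-decidable)
open import Data.Sum using (_⊎_; inj₁; inj₂; [_,_]′)
open import Function.Base using (_∘_; id)
open import Function.Bundles using (module Equivalence; module Inverse)
open import Level using (Level; _⊔_; lift)
open import Relation.Binary.Bundles using (Setoid)
open import Relation.Binary.Definitions using (tri<; tri≈; tri>) renaming (Decidable to Decidable₂)
open import Relation.Binary.PropositionalEquality as ≡ using (_≡_)
import Relation.Binary.Reasoning.Setoid as SetoidReasoning
open import Relation.Nullary using (Dec; ¬_; yes; no; contradiction)
open import Relation.Nullary.Decidable using (decidable-stable; map′)
open import Relation.Unary using (Decidable; Pred)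

private
  variable
    c ℓ : Level

-- Arithmetic

infix 4 _≡_[mod_]
-- Congruence of natural numbers without subtraction: each side is padded by its own multiple of the
-- modulus, which is how `⋆-mod` uses it.
_≡_[mod_] : ℕ → ℕ → ℕ → Set
a ≡ b [mod m ] = ∃₂ λ x y → a + x * m ≡ b + y * m

least : ∀ {p} {P : ℕ → Set p} → Decidable P → ∀ n → P n →
        ∃ λ m → P m × (∀ {i} → i < m → ¬ P i)
least {P = P} P? n Pn = [ id , (λ none → n , Pn , none) ]′ (search n)
  where
  search : ∀ n → (∃ λ m → P m × (∀ {i} → i < m → ¬ P i)) ⊎ (∀ {i} → i < n → ¬ P i)
  search zero = inj₂ λ ()
  search (suc n) with search n
  ... | inj₁ found = inj₁ found
  ... | inj₂ none with P? n
  ...   | yes Pn = inj₁ (n , Pn , none)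
  ...   | no ¬Pn = inj₂ λ i<1+n Pi →
          [ (λ i<n → none i<n Pi) , (λ { ≡.refl → ¬Pn Pi }) ]′ (m<1+n⇒m<n∨m≡n i<1+n)

coprime-inverse : ∀ {a b} → Coprime a b → ∃ λ s → s * a ≡ 1 [mod b ]
coprime-inverse {a} {b} a⊥b with coprime-Bézout a⊥b
... | Bézout.+- x y eq = x , 0 , y , ≡.trans (+-identityʳ (x * a)) (≡.sym eq)
-- Here c = x a is −1 modulo b, so that c² is 1.
... | Bézout.-+ x y eq = x * a * x , y , x * a * y , (begin
  x * a * x * a + y * b          ≡⟨ ≡.cong (x * a * x * a +_) eq ⟨
  x * a * x * a + (1 + x * a)    ≡⟨ square x a ⟩
  1 + x * a * (1 + x * a)        ≡⟨ ≡.cong (λ z → 1 + x * a * z) eq ⟩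
  1 + x * a * (y * b)            ≡⟨ ≡.cong (1 +_) (*-assoc (x * a) y b) ⟨
  1 + x * a * y * b              ∎)
  where
  open ≡.≡-Reasoning
  square : ∀ x a → x * a * x * a + (1 + x * a) ≡ 1 + x * a * (1 + x * a)
  square = solve-∀

-- `v * b` is 1 modulo `a` and 0 modulo `b`, and `u * a` the other way round.
chinese-remainder : ∀ {a b} → Coprime a b → ∀ s t →
                    ∃ λ A → A ≡ s [mod a ] × A ≡ t [mod b ]
chinese-remainder {a} {b} a⊥b s t
  with u , u₁ , u₂ , ua≡1 ← coprime-inverse a⊥b
     | v , v₁ , v₂ , vb≡1 ← coprime-inverse (Coprimality.sym a⊥b)
  = s * (v * b) + t * (u * a)
  , (s * v₁ , s * v₂ + t * u , (begin
      s * (v * b) + t * (u * a) + s * v₁ * a    ≡⟨ left s t u a v b v₁ ⟩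
      s * (v * b + v₁ * a) + t * u * a          ≡⟨ ≡.cong (λ z → s * z + t * u * a) vb≡1 ⟩
      s * (1 + v₂ * a) + t * u * a              ≡⟨ right s t u a v₂ ⟩
      s + (s * v₂ + t * u) * a                  ∎))
  , (t * u₁ , t * u₂ + s * v , (begin
      s * (v * b) + t * (u * a) + t * u₁ * b    ≡⟨ ≡.cong (_+ t * u₁ * b) (+-comm (s * (v * b)) _) ⟩
      t * (u * a) + s * (v * b) + t * u₁ * b    ≡⟨ left t s v b u a u₁ ⟩
      t * (u * a + u₁ * b) + s * v * b          ≡⟨ ≡.cong (λ z → t * z + s * v * b) ua≡1 ⟩
      t * (1 + u₂ * b) + s * v * b              ≡⟨ right t s v b u₂ ⟩
      t + (t * u₂ + s * v) * b                  ∎))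
  where
  open ≡.≡-Reasoning
  left : ∀ s t u a v b v₁ → s * (v * b) + t * (u * a) + s * v₁ * a ≡ s * (v * b + v₁ * a) + t * u * a
  left = solve-∀
  right : ∀ s t u a v₂ → s * (1 + v₂ * a) + t * u * a ≡ s + (s * v₂ + t * u) * a
  right = solve-∀

coprime-* : ∀ {a b c} → Coprime a b → Coprime a c → Coprime a (b * c)
coprime-* a⊥b a⊥c (d∣a , d∣bc) = a⊥c
  (d∣a , coprime-divisor (λ (e∣d , e∣b) → a⊥b (∣-trans e∣d d∣a , e∣b)) d∣bc)

coprime-^ : ∀ {a b} n → Coprime a b → Coprime a (b ^ n)
coprime-^ zero    _   (_ , d∣1) = ∣1⇒≡1 d∣1
coprime-^ (suc n) a⊥b = coprime-* a⊥b (coprime-^ n a⊥b)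

∤⇒coprime : ∀ {p a} → Prime p → ¬ p ∣ a → Coprime a p
∤⇒coprime p-prime p∤a (d∣a , d∣p) with prime⇒irreducible p-prime d∣p
... | inj₁ d≡1 = d≡1
... | inj₂ ≡.refl = contradiction d∣a p∤a

∣^⇒∣ : ∀ {p} → Prime p → ∀ a n → p ∣ a ^ n → p ∣ a
∣^⇒∣ p-prime a zero    p∣1 = contradiction (∣1⇒≡1 p∣1) (nonTrivial⇒≢1 {{prime⇒nonTrivial p-prime}})
∣^⇒∣ p-prime a (suc n) p∣aⁿ⁺¹ = [ id , ∣^⇒∣ p-prime a n ]′ (euclidsLemma a (a ^ n) p-prime p∣aⁿ⁺¹)

-- Supplies one exponent for all Sylow factors except the first, still prime to the order of the
-- first.
coprime-multiple : ∀ {m} c (e : Fin m → ℕ) → (∀ i → Coprime c (e i)) →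
                   ∃ λ M → Coprime c M × (∀ i → e i ∣ M)
coprime-multiple {zero}  c e c⊥e = 1 , (λ (_ , d∣1) → ∣1⇒≡1 d∣1) , λ ()
coprime-multiple {suc m} c e c⊥e with M , c⊥M , e∣M ← coprime-multiple c (e ∘ suc) (c⊥e ∘ suc) =
  e zero * M , coprime-* (c⊥e zero) c⊥M ,
  λ { zero → m∣m*n M ; (suc i) → ∣n⇒∣m*n (e zero) (e∣M i) }

odd-half : ∀ {n} → ¬ 2 ∣ n → ∃ λ h → n ≡ 1 + 2 * h
odd-half {zero}        2∤n = contradiction (2 ∣0) 2∤n
odd-half {suc zero}    2∤n = 0 , ≡.refl
odd-half {suc (suc n)} 2∤n with h , eq ← odd-half {n} (2∤n ∘ ∣m∣n⇒∣m+n ∣-refl) =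
  suc h , ≡.trans (≡.cong (2 +_) eq) (≡.cong suc (≡.sym (*-suc 2 h)))

-- The sum 1 + s + ... + s^(n-1). If y g = g^s y, it is the exponent of g when (g y)^n is written
-- with the powers of g first; see `⋆-product`.
geometric : ℕ → ℕ → ℕ
geometric s zero    = 0
geometric s (suc n) = 1 + s * geometric s n

-- Each power (1 + v p)^i is 1 + i v p modulo p², so the linear terms add up to v p times the
-- triangular number `T`; `W` collects the rest.
geometric-expansion : ∀ p v n → ∃₂ λ T W →
  2 * T ≡ n * (n ∸ 1) × geometric (1 + v * p) n ≡ n + v * p * T + p * p * W
geometric-expansion p v zero =
  0 , 0 , ≡.refl , ≡.sym (≡.cong₂ _+_ (*-zeroʳ (v * p)) (*-zeroʳ (p * p)))
geometric-expansion p v (suc n) with T , W , 2T≡ , S≡ ← geometric-expansion p v n =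
  T + n , W + v * v * T + v * p * W , triangular n T 2T≡ , (begin
    1 + (1 + v * p) * geometric (1 + v * p) n                ≡⟨ ≡.cong (λ z → 1 + (1 + v * p) * z) S≡ ⟩
    1 + (1 + v * p) * (n + v * p * T + p * p * W)            ≡⟨ expand p v n T W ⟩
    suc n + v * p * (T + n) + p * p * (W + v * v * T + v * p * W) ∎)
  where
  open ≡.≡-Reasoning
  expand : ∀ p v n T W → 1 + (1 + v * p) * (n + v * p * T + p * p * W) ≡
           suc n + v * p * (T + n) + p * p * (W + v * v * T + v * p * W)
  expand = solve-∀
  triangular : ∀ n T → 2 * T ≡ n * (n ∸ 1) → 2 * (T + n) ≡ suc n * n
  triangular zero    T eq = ≡.trans (*-distribˡ-+ 2 T 0) (≡.trans (+-identityʳ (2 * T)) eq)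
  triangular (suc n) T eq = begin
    2 * (T + suc n)          ≡⟨ *-distribˡ-+ 2 T (suc n) ⟩
    2 * T + 2 * suc n        ≡⟨ ≡.cong (_+ 2 * suc n) eq ⟩
    suc n * n + 2 * suc n    ≡⟨ shape n ⟩
    suc (suc n) * suc n      ∎
    where
    shape : ∀ n → suc n * n + 2 * suc n ≡ suc (suc n) * suc n
    shape = solve-∀

-- Oddness enters here: for p = 1 + 2h the triangular number p (p - 1) / 2 is p h, so every term
-- after the leading p is a multiple of p².
geometric-odd : ∀ {p} v → ¬ 2 ∣ p → ∃ λ X → geometric (1 + v * p) p ≡ (1 + X * p) * p
geometric-odd {p} v 2∤p with h , ≡.refl ← odd-half 2∤p | T , W , 2T≡ , S≡ ← geometric-expansion p v p =
  v * h + W , (begin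
    geometric (1 + v * p) p              ≡⟨ S≡ ⟩
    p + v * p * T + p * p * W            ≡⟨ ≡.cong (λ z → p + v * p * z + p * p * W) T≡ ⟩
    p + v * p * (p * h) + p * p * W      ≡⟨ shape p v h W ⟩
    (1 + (v * h + W) * p) * p            ∎)
  where
  open ≡.≡-Reasoning
  T≡ : T ≡ p * h
  T≡ = *-cancelˡ-≡ T (p * h) 2 (≡.trans 2T≡ (swap p h))
    where
    swap : ∀ p h → p * (2 * h) ≡ 2 * (p * h)
    swap = solve-∀
  shape : ∀ p v h W → p + v * p * (p * h) + p * p * W ≡ (1 + (v * h + W) * p) * p
  shape = solve-∀

-- If every value were attained, choosing preimages would inject `Fin n` into the smaller `Fin m`.
missed : ∀ {m n} → m < n → (f : Fin m → Fin n) → ∃ λ j → ∀ i → ¬ f i ≡ j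
missed {m} {n} m<n f =
  let j , ¬hit = Fin.¬∀⟶∃¬ n (λ j → ∃ λ i → f i ≡ j) (λ j → Fin.any? λ i → f i Fin.≟ j) λ onto →
        <⇒≱ m<n (Fin.injective⇒≤ {f = proj₁ ∘ onto} λ {j} {j′} eq →
          ≡.trans (≡.sym (proj₂ (onto j))) (≡.trans (≡.cong f eq) (proj₂ (onto j′))))
  in j , λ i fi≡j → ¬hit (i , fi≡j)

-- Powers and Lagrange's theorem

module Remove (S : Setoid c ℓ) where
  open Setoid S
  open Membership S using (_∈_; _∉_)
  open UniqueSetoid S using (Unique)

  remove : ∀ {a L} → Unique L → a ∈ L →
           ∃ λ L′ → Unique L′ × length L ≡ suc (length L′)
                  × (∀ {x} → x ∈ L → ¬ x ≈ a → x ∈ L′)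
                  × (∀ {x} → x ∈ L′ → x ∈ L × ¬ x ≈ a)
  remove {a} {b ∷ L} (b∉L ∷ uL) (here a≈b) =
    L , uL , ≡.refl
    , (λ { (here x≈b) x≉a → contradiction (trans x≈b (sym a≈b)) x≉a ; (there x∈L) _ → x∈L })
    , λ x∈L → there x∈L , λ x≈a →
        All.lookupₛ S (λ x≈y b≉x b≈y → b≉x (trans b≈y (sym x≈y))) b∉L x∈L (sym (trans x≈a a≈b))
  remove {a} {b ∷ L} (b∉L ∷ uL) (there a∈L)
    with L′ , uL′ , len , keep , back ← remove uL a∈L =
    b ∷ L′ , All.tabulateₛ S (λ x∈L′ → b≉ (proj₁ (back x∈L′))) ∷ uL′ , ≡.cong suc len
    , (λ { (here x≈b) _ → here x≈b ; (there x∈L) x≉a → there (keep x∈L x≉a) })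
    , λ { (here x≈b) → here x≈b , (λ x≈a → b≉ a∈L (trans (sym x≈b) x≈a))
        ; (there x∈L′) → there (proj₁ (back x∈L′)) , proj₂ (back x∈L′) }
    where
    b≉ : ∀ {x} → x ∈ L → ¬ b ≈ x
    b≉ = All.lookupₛ S (λ x≈y b≉x b≈y → b≉x (trans b≈y (sym x≈y))) b∉L

  removeAll : ∀ {O L} → Unique O → Unique L → (∀ {x} → x ∈ O → x ∈ L) →
              ∃ λ L′ → Unique L′ × length L ≡ length O + length L′
                     × (∀ {x} → x ∈ L → x ∉ O → x ∈ L′)
                     × (∀ {x} → x ∈ L′ → x ∈ L × x ∉ O)
  removeAll {[]} {L} [] uL _ = L , uL , ≡.refl , (λ x∈L _ → x∈L) , λ x∈L → x∈L , λ ()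
  removeAll {b ∷ O} (b∉O ∷ uO) uL O⊆L
    with L₁ , uL₁ , len₁ , keep₁ , back₁ ← remove uL (O⊆L (here refl))
    with L₂ , uL₂ , len₂ , keep₂ , back₂ ← removeAll uO uL₁ (λ x∈O → keep₁ (O⊆L (there x∈O)) λ x≈b →
           All.lookupₛ S (λ x≈y b≉x b≈y → b≉x (trans b≈y (sym x≈y))) b∉O x∈O (sym x≈b)) =
    L₂ , uL₂ , ≡.trans len₁ (≡.cong suc len₂)
    , (λ x∈L x∉bO → keep₂ (keep₁ x∈L (x∉bO ∘ here)) (x∉bO ∘ there))
    , λ x∈L₂ → proj₁ (back₁ (proj₁ (back₂ x∈L₂)))
             , λ { (here x≈b) → proj₂ (back₁ (proj₁ (back₂ x∈L₂))) x≈b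
                 ; (there x∈O) → proj₂ (back₂ x∈L₂) x∈O }

module Finite (S : Setoid c ℓ) {n} (card : HasCardinality S n) where
  open Setoid S
  open Inverse card public using (to; from; to-cong; from-cong)
  open Inverse card using (strictlyInverseˡ; strictlyInverseʳ)

  to-from : ∀ i → to (from i) ≡ i
  to-from = strictlyInverseˡ

  from-to : ∀ x → from (to x) ≈ x
  from-to = strictlyInverseʳ

  to-injective : ∀ {x y} → to x ≡ to y → x ≈ y
  to-injective {x} {y} eq = trans (sym (from-to x)) (trans (from-cong eq) (from-to y))

  from-injective : ∀ {i j} → from i ≈ from j → i ≡ j
  from-injective {i} {j} eq = ≡.trans (≡.sym (to-from i)) (≡.trans (to-cong eq) (to-from j))

  _≟_ : Decidable₂ _≈_
  x ≟ y = map′ to-injective to-cong (to x Fin.≟ to y)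

  module _ {p} {P : Pred Carrier p} (P-resp : ∀ {x y} → x ≈ y → P x → P y) (P? : Decidable P) where

    all? : Dec (∀ x → P x)
    all? = map′ (λ ∀P x → P-resp (from-to x) (∀P (to x))) (_∘ from) (Fin.all? (P? ∘ from))

    ¬∀⇒∃¬ : ¬ (∀ x → P x) → ∃ λ x → ¬ P x
    ¬∀⇒∃¬ ¬∀P = let i , ¬Pi = Fin.¬∀⟶∃¬ n (P ∘ from) (P? ∘ from)
                                (λ ∀P → ¬∀P λ x → P-resp (from-to x) (∀P (to x)))
                in from i , ¬Pi

  surjection⇒≤ : ∀ {m} (f : Fin m → Carrier) → (∀ x → ∃ λ i → x ≈ f i) → n ≤ m
  surjection⇒≤ f f-onto = Fin.injective⇒≤ {f = λ i → proj₁ (f-onto (from i))} λ {i} {j} eq →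
    from-injective (trans (proj₂ (f-onto (from i)))
                          (trans (reflexive (≡.cong f eq)) (sym (proj₂ (f-onto (from j))))))

module Powers (G : Group c ℓ) where
  open Group G
  open GroupProperties G using (∙-cancelˡ; inverseʳ-unique)
  open Mult monoid public
    using ()
    renaming ( _×_ to infixr 7.5 _⋆_; ×-congʳ to ⋆-congʳ; ×-congˡ to ⋆-congˡ
             ; ×-homo-1 to 1⋆; ×-homo-+ to ⋆-+; ×-assocˡ to ⋆-⋆ )
  open SetoidReasoning setoid

  ⋆-ε : ∀ n → n ⋆ ε ≈ ε
  ⋆-ε zero    = refl
  ⋆-ε (suc n) = trans (identityˡ _) (⋆-ε n)

  *-⋆-vanishes : ∀ {e x} n → e ⋆ x ≈ ε → (n * e) ⋆ x ≈ ε
  *-⋆-vanishes {e} {x} n ex≈ε = trans (sym (⋆-⋆ x n e)) (trans (⋆-congʳ n ex≈ε) (⋆-ε n))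

  ∣-⋆-vanishes : ∀ {e m x} → e ∣ m → e ⋆ x ≈ ε → m ⋆ x ≈ ε
  ∣-⋆-vanishes (divides q ≡.refl) = *-⋆-vanishes q

  ⋆-mod : ∀ {a b e x} → a ≡ b [mod e ] → e ⋆ x ≈ ε → a ⋆ x ≈ b ⋆ x
  ⋆-mod {a} {b} {e} {x} (m , n , eq) ex≈ε = begin
    a ⋆ x                  ≈⟨ pad a m ⟨
    (a + m * e) ⋆ x        ≈⟨ ⋆-congˡ eq ⟩
    (b + n * e) ⋆ x        ≈⟨ pad b n ⟩
    b ⋆ x                  ∎
    where
    pad : ∀ a m → (a + m * e) ⋆ x ≈ a ⋆ x
    pad a m = trans (⋆-+ x a (m * e)) (trans (∙-congˡ (*-⋆-vanishes m ex≈ε)) (identityʳ _))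

  ⋆-inverse : ∀ {a b x} → Coprime a b → b ⋆ x ≈ ε → ∃ λ s → s ⋆ a ⋆ x ≈ x
  ⋆-inverse {a} {x = x} a⊥b bx≈ε with s , sa≡1 ← coprime-inverse a⊥b =
    s , trans (⋆-⋆ x s a) (trans (⋆-mod sa≡1 bx≈ε) (1⋆ x))

  coprime-vanishes : ∀ {a b x} → Coprime a b → a ⋆ x ≈ ε → b ⋆ x ≈ ε → x ≈ ε
  coprime-vanishes a⊥b ax≈ε bx≈ε with s , sax≈x ← ⋆-inverse a⊥b bx≈ε =
    trans (sym sax≈x) (trans (⋆-congʳ s ax≈ε) (⋆-ε s))

  ⋆-⁻¹ : ∀ {e x} .{{_ : NonZero e}} n → e ⋆ x ≈ ε → (n ⋆ x) ⁻¹ ≈ (n * (e ∸ 1)) ⋆ x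
  ⋆-⁻¹ {suc e} {x} n ex≈ε = sym (inverseʳ-unique (n ⋆ x) _ (begin
    n ⋆ x ∙ (n * e) ⋆ x    ≈⟨ ⋆-+ x n (n * e) ⟨
    (n + n * e) ⋆ x        ≈⟨ ⋆-congˡ (*-suc n e) ⟨
    (n * suc e) ⋆ x        ≈⟨ *-⋆-vanishes n ex≈ε ⟩
    ε                      ∎))

  -- The hypothesis is y x y⁻¹ = x^s freed of inverses: each x that y passes becomes x^s.
  conjugate-⋆ : ∀ {x y s} → y ∙ x ≈ s ⋆ x ∙ y → ∀ n → y ∙ n ⋆ x ≈ (n * s) ⋆ x ∙ y
  conjugate-⋆ {x} {y} {s} yx≈ zero    = trans (identityʳ y) (sym (identityˡ y))
  conjugate-⋆ {x} {y} {s} yx≈ (suc n) = begin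
    y ∙ (x ∙ n ⋆ x)                  ≈⟨ assoc _ _ _ ⟨
    y ∙ x ∙ n ⋆ x                    ≈⟨ ∙-congʳ yx≈ ⟩
    s ⋆ x ∙ y ∙ n ⋆ x                ≈⟨ assoc _ _ _ ⟩
    s ⋆ x ∙ (y ∙ n ⋆ x)              ≈⟨ ∙-congˡ (conjugate-⋆ yx≈ n) ⟩
    s ⋆ x ∙ ((n * s) ⋆ x ∙ y)        ≈⟨ assoc _ _ _ ⟨
    s ⋆ x ∙ (n * s) ⋆ x ∙ y          ≈⟨ ∙-congʳ (⋆-+ x s (n * s)) ⟨
    (s + n * s) ⋆ x ∙ y              ∎

  ∙-⋆-comm : ∀ x n → x ∙ n ⋆ x ≈ n ⋆ x ∙ x
  ∙-⋆-comm x n = trans (conjugate-⋆ {s = 1} (∙-congʳ (sym (1⋆ x))) n) (∙-congʳ (⋆-congˡ (*-identityʳ n)))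

  infix 4 _∈⟪_⟫
  -- Natural exponents suffice under a finite exponent, where `⋆-⁻¹` turns inverses into natural
  -- powers; `∈⟨⟩⇒∈⟪⟫` removes the integers of the graph's definition.
  _∈⟪_⟫ : Carrier → Carrier → Set ℓ
  u ∈⟪ w ⟫ = ∃ λ n → u ≈ n ⋆ w

  ε∈⟪⟫ : ∀ {w} → ε ∈⟪ w ⟫
  ε∈⟪⟫ = 0 , refl

  self∈⟪⟫ : ∀ {w} → w ∈⟪ w ⟫
  self∈⟪⟫ {w} = 1 , sym (1⋆ w)

  ⋆∈⟪⟫ : ∀ {w} n → n ⋆ w ∈⟪ w ⟫
  ⋆∈⟪⟫ n = n , refl

  ∈⟪⟫-resp : ∀ {u v w} → u ≈ v → u ∈⟪ w ⟫ → v ∈⟪ w ⟫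
  ∈⟪⟫-resp u≈v (n , u≈) = n , trans (sym u≈v) u≈

  ∈⟪⟫-trans : ∀ {u v w} → u ∈⟪ v ⟫ → v ∈⟪ w ⟫ → u ∈⟪ w ⟫
  ∈⟪⟫-trans {w = w} (m , u≈) (n , v≈) =
    m * n , trans u≈ (trans (⋆-congʳ m v≈) (⋆-⋆ w m n))

  ∈⟪⟫-∙ : ∀ {u v w} → u ∈⟪ w ⟫ → v ∈⟪ w ⟫ → u ∙ v ∈⟪ w ⟫
  ∈⟪⟫-∙ {w = w} (m , u≈) (n , v≈) = m + n , trans (∙-cong u≈ v≈) (sym (⋆-+ w m n))

  ∈⟪⟫-⁻¹ : ∀ {u w e} .{{_ : NonZero e}} → e ⋆ w ≈ ε → u ∈⟪ w ⟫ → u ⁻¹ ∈⟪ w ⟫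
  ∈⟪⟫-⁻¹ {e = e} ew≈ε (n , u≈) = n * (e ∸ 1) , trans (⁻¹-cong u≈) (⋆-⁻¹ n ew≈ε)

  ∈⟨⟩⇒∈⟪⟫ : ∀ {u w e} .{{_ : NonZero e}} → e ⋆ w ≈ ε → ⟨_⟩ G w u → u ∈⟪ w ⟫
  ∈⟨⟩⇒∈⟪⟫ ew≈ε (ℤ.+ n , u≈)      = n , u≈
  ∈⟨⟩⇒∈⟪⟫ ew≈ε (ℤ.-[1+ n ] , u≈) = ∈⟪⟫-resp (sym u≈) (∈⟪⟫-⁻¹ ew≈ε (⋆∈⟪⟫ (suc n)))

  ∈⟪⟫⇒∈⟨⟩ : ∀ {u w} → u ∈⟪ w ⟫ → ⟨_⟩ G w u
  ∈⟪⟫⇒∈⟨⟩ (n , u≈) = ℤ.+ n , u≈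

  ⋆-% : ∀ {e x} .{{_ : NonZero e}} n → e ⋆ x ≈ ε → n ⋆ x ≈ (n % e) ⋆ x
  ⋆-% {e} n = ⋆-mod (0 , n / e , ≡.trans (+-identityʳ n) (m≡m%n+[m/n]*n n e))

  ∈⟪⟫⇒Fin : ∀ {u w e} .{{_ : NonZero e}} → e ⋆ w ≈ ε → u ∈⟪ w ⟫ → ∃ λ (i : Fin e) → u ≈ toℕ i ⋆ w
  ∈⟪⟫⇒Fin {e = e} ew≈ε (n , u≈) =
    Fin.fromℕ< (m%n<n n e) , trans u≈ (trans (⋆-% n ew≈ε) (⋆-congˡ (≡.sym (Fin.toℕ-fromℕ< (m%n<n n e)))))

  ∈⟪⟫? : ∀ {e} .{{_ : NonZero e}} → Decidable₂ _≈_ → ∀ u w → e ⋆ w ≈ ε → Dec (u ∈⟪ w ⟫)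
  ∈⟪⟫? _≟_ u w ew≈ε = map′ (λ (i , u≈) → toℕ i , u≈) (∈⟪⟫⇒Fin ew≈ε) (Fin.any? λ i → u ≟ (toℕ i ⋆ w))

  ⋆-cancel : ∀ {m n x} → m ⋆ x ≈ n ⋆ x → m ≤ n → (n ∸ m) ⋆ x ≈ ε
  ⋆-cancel {m} {n} {x} mx≈nx m≤n = sym (∙-cancelˡ (m ⋆ x) _ _ (begin
    m ⋆ x ∙ ε              ≈⟨ identityʳ _ ⟩
    m ⋆ x                  ≈⟨ mx≈nx ⟩
    n ⋆ x                  ≈⟨ ⋆-congˡ (m+[n∸m]≡n m≤n) ⟨
    (m + (n ∸ m)) ⋆ x      ≈⟨ ⋆-+ x m (n ∸ m) ⟩
    m ⋆ x ∙ (n ∸ m) ⋆ x    ∎))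

  module _ {d x} (minimal : ∀ {i} → i < d → ¬ suc i ⋆ x ≈ ε) where
    -- Equality would make the difference of the exponents, a positive number at most `d`,
    -- annihilate `x`.
    ⋆-distinct : ∀ {i j} → i < j → j ≤ d → ¬ i ⋆ x ≈ j ⋆ x
    ⋆-distinct {i} {suc j} i<1+j@(s≤s i≤j) j<d eq = minimal (≤-<-trans (m∸n≤m j i) j<d)
      (trans (⋆-congˡ (≡.sym (+-∸-assoc 1 i≤j))) (⋆-cancel eq (<⇒≤ i<1+j)))

    ⋆-injective : ∀ {i j} → i ≤ d → j ≤ d → i ⋆ x ≈ j ⋆ x → i ≡ j
    ⋆-injective {i} {j} i≤d j≤d eq with <-cmp i j
    ... | tri≈ _ i≡j _ = i≡j
    ... | tri< i<j _ _ = contradiction eq (⋆-distinct i<j j≤d)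
    ... | tri> _ _ j<i = contradiction (sym eq) (⋆-distinct j<i i≤d)

module Lagrange (G : Group c ℓ) {N} (order : HasOrder G N) where
  open Group G
  open Powers G
  open Finite setoid order
  open GroupProperties G using (∙-cancelˡ; ∙-cancelʳ)
  open Membership setoid using (_∈_; _∉_)
  open UniqueSetoid setoid using (Unique)
  open Remove setoid
  open SetoidReasoning setoid

  -- Two of the N + 1 powers with exponents 0 to N coincide. The form `suc n` records that their
  -- difference is positive.
  some-order : ∀ g → ∃ λ n → suc n ⋆ g ≈ ε
  some-order g with i , j , i<j , eq ← Fin.pigeonhole (n<1+n N) (λ i → to (toℕ i ⋆ g)) =
    toℕ j ∸ suc (toℕ i) , trans (⋆-congˡ (≡.sym (+-∸-assoc 1 i<j))) (⋆-cancel (to-injective eq) (<⇒≤ i<j))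

  module Orbit (g : Carrier) {d} (dg≈ε : suc d ⋆ g ≈ ε) (minimal : ∀ {i} → i < d → ¬ suc i ⋆ g ≈ ε) where
    private
      move : Carrier → Fin (suc d) → Carrier
      move a i = toℕ i ⋆ g ∙ a

      orbit : Carrier → List Carrier
      orbit a = tabulate (move a)

      length-orbit : ∀ a → length (orbit a) ≡ suc d
      length-orbit a = length-tabulate (move a)

      orbit-unique : ∀ a → Unique (orbit a)
      orbit-unique a = Unique.tabulate⁺ setoid {f = move a} λ {i} {j} eq → Fin.toℕ-injective
        (⋆-injective minimal (s≤s⁻¹ (Fin.toℕ<n i)) (s≤s⁻¹ (Fin.toℕ<n j)) (∙-cancelʳ a _ _ eq))

      ∈-orbit : ∀ {x a i} → i ≤ d → x ≈ i ⋆ g ∙ a → x ∈ orbit a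
      ∈-orbit {i = i} i≤d x≈ = ∈ₚ.∈-resp-≈ setoid
        (trans (∙-congʳ (⋆-congˡ (Fin.toℕ-fromℕ< (s≤s i≤d)))) (sym x≈))
        (∈ₚ.∈-tabulate⁺ setoid {f = move _} (fromℕ< (s≤s i≤d)))

      -- Used in contrapositive form: once an orbit is removed, `g` moves no remaining element into
      -- it.
      orbit-∙⁻ : ∀ {x a} → g ∙ x ∈ orbit a → x ∈ orbit a
      orbit-∙⁻ {x} {a} gx∈ with ∈ₚ.∈-tabulate⁻ setoid {f = move a} gx∈
      -- From index 0 the orbit wraps round to exponent `d`, because g^(d+1) = 1.
      ... | zero , gx≈ = ∈-orbit ≤-refl (∙-cancelˡ g _ _ (begin
        g ∙ x               ≈⟨ gx≈ ⟩
        ε ∙ a               ≈⟨ ∙-congʳ dg≈ε ⟨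
        (suc d ⋆ g) ∙ a     ≈⟨ assoc _ _ _ ⟩
        g ∙ (d ⋆ g ∙ a)     ∎))
      ... | suc i , gx≈ = ∈-orbit (<⇒≤ (Fin.toℕ<n i)) (∙-cancelˡ g _ _ (trans gx≈ (assoc _ _ _)))

      orbit⊆ : ∀ {a L} → (∀ {x} → x ∈ L → g ∙ x ∈ L) → a ∈ L → ∀ {x} → x ∈ orbit a → x ∈ L
      orbit⊆ {a} {L} closed a∈L x∈ =
        let i , x≈ = ∈ₚ.∈-tabulate⁻ setoid {f = move a} x∈ in ∈ₚ.∈-resp-≈ setoid (sym x≈) (⋆∈ (toℕ i))
        where
        ⋆∈ : ∀ i → i ⋆ g ∙ a ∈ L
        ⋆∈ zero    = ∈ₚ.∈-resp-≈ setoid (sym (identityˡ a)) a∈L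
        ⋆∈ (suc i) = ∈ₚ.∈-resp-≈ setoid (sym (assoc _ _ _)) (closed (⋆∈ i))

    -- Left multiplication by `g` splits the list into orbits of size `suc d`; one is removed per
    -- step. `n` carries the recursion, which is not structural in `L`.
    ∣-length : ∀ n L → length L ≤ n → Unique L → (∀ {x} → x ∈ L → g ∙ x ∈ L) → suc d ∣ length L
    ∣-length n [] _ _ _ = suc d ∣0
    ∣-length (suc n) (a ∷ L) (s≤s len≤) uL closed
      with L′ , uL′ , len , keep , back ← removeAll (orbit-unique a) uL (orbit⊆ closed (here refl))
      = ≡.subst (suc d ∣_) (≡.sym (≡.trans len (≡.cong (_+ length L′) (length-orbit a))))
          (∣m∣n⇒∣m+n ∣-refl (∣-length n L′ len′≤ uL′ λ x∈L′ →
            keep (closed (proj₁ (back x∈L′))) (proj₂ (back x∈L′) ∘ orbit-∙⁻)))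
      where
      len′≤ : length L′ ≤ n
      len′≤ = ≤-trans (≤-trans (m≤n+m (length L′) d)
        (≤-reflexive (suc-injective (≡.sym (≡.trans len (≡.cong (_+ length L′) (length-orbit a))))))) len≤

  -- Lagrange's argument for a list rather than for the group, so that it serves both the whole
  -- group and, in `generator-order`, a subgroup.
  length-⋆ : ∀ g L → Unique L → (∀ {x} → x ∈ L → g ∙ x ∈ L) → length L ⋆ g ≈ ε
  length-⋆ g L uL closed
    with n , ng≈ε ← some-order g
    with d , dg≈ε , minimal ← least (λ i → (suc i ⋆ g) ≟ ε) n ng≈ε =
    ∣-⋆-vanishes (Orbit.∣-length g dg≈ε minimal _ L ≤-refl uL closed) dg≈ε

  order-⋆ : ∀ g → N ⋆ g ≈ ε
  order-⋆ g = trans (⋆-congˡ (≡.sym (length-tabulate from)))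
    (length-⋆ g (tabulate from) (Unique.tabulate⁺ setoid {f = from} from-injective) λ {x} _ →
      ∈ₚ.∈-resp-≈ setoid (from-to (g ∙ x)) (∈ₚ.∈-tabulate⁺ setoid {f = from} (to (g ∙ x))))

-- Domination and products

module Domination (G : Group c ℓ) where
  open Group G
  open Powers G

  Exponent : ℕ → Set (c ⊔ ℓ)
  Exponent e = ∀ g → e ⋆ g ≈ ε

  -- Adjacency without distinctness: unlike adjacency itself, this relation is determined
  -- componentwise in a product of coprime exponents.
  Joined : Carrier → Carrier → Set (c ⊔ ℓ)
  Joined u v = ∃ λ w → u ∈⟪ w ⟫ × v ∈⟪ w ⟫

  Universal : Pred Carrier (c ⊔ ℓ)
  Universal u = ∀ v → Joined u v

  Joined-refl : ∀ {u} → Joined u u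
  Joined-refl {u} = u , self∈⟪⟫ , self∈⟪⟫

  Joined-sym : ∀ {u v} → Joined u v → Joined v u
  Joined-sym (w , u∈ , v∈) = w , v∈ , u∈

  Joined-respʳ : ∀ {u v v′} → v ≈ v′ → Joined u v → Joined u v′
  Joined-respʳ v≈v′ (w , u∈ , v∈) = w , u∈ , ∈⟪⟫-resp v≈v′ v∈

  Joined-respˡ : ∀ {u u′ v} → u ≈ u′ → Joined u v → Joined u′ v
  Joined-respˡ u≈u′ (w , u∈ , v∈) = w , ∈⟪⟫-resp u≈u′ u∈ , v∈

  ε-universal : Universal ε
  ε-universal v = v , ε∈⟪⟫ , self∈⟪⟫

  -- Fewer than γ elements outside T never dominate all of G.
  Escapes : ∀ {p} → Pred Carrier p → ℕ → Set (c ⊔ ℓ ⊔ p)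
  Escapes T γ = ∀ {n} → n < γ → (d : Fin n → Carrier) → ∃ λ v → ∀ i → Joined v (d i) → T (d i)

  -- The upper bound: such elements form a dominating set, and `rep-¬universal` keeps them among the
  -- vertices of the proper graph.
  record Representatives (γ : ℕ) : Set (c ⊔ ℓ) where
    field
      rep            : Fin γ → Carrier
      rep-injective  : ∀ {i j} → rep i ≈ rep j → i ≡ j
      rep-¬universal : ∀ i → ¬ Universal (rep i)
      rep-covers     : ∀ g → ∃ λ i → Joined (rep i) g

  Escapes-anti : ∀ {p} {T : Pred Carrier p} {γ δ} → γ ≤ δ → Escapes T δ → Escapes T γ
  Escapes-anti γ≤δ escapes n<γ = escapes (<-≤-trans n<γ γ≤δ)

  module _ (_≟_ : Decidable₂ _≈_) {e} .{{_ : NonZero e}} (exponent : Exponent e) where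

    private
      Γ = enhancedPowerGraph G

      dominating⇒universal : ∀ {u} → IsDominatingVertex Γ u → Universal u
      dominating⇒universal {u} dominating v with u ≟ v
      ... | yes u≈v = Joined-respʳ u≈v Joined-refl
      ... | no u≉v with _ , w , u∈ , v∈ ← dominating v u≉v =
        w , ∈⟨⟩⇒∈⟪⟫ (exponent w) u∈ , ∈⟨⟩⇒∈⟪⟫ (exponent w) v∈

      joined⇒adjacent : ∀ {u v} → ¬ u ≈ v → Joined u v → SimpleGraph._~_ Γ u v
      joined⇒adjacent u≉v (w , u∈ , v∈) = u≉v , w , ∈⟪⟫⇒∈⟨⟩ u∈ , ∈⟪⟫⇒∈⟨⟩ v∈

      universal⇒dominating : ∀ {u} → Universal u → IsDominatingVertex Γ u
      universal⇒dominating universal v u≉v = joined⇒adjacent u≉v (universal v)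

      adjacent⇒joined : ∀ {u v} → SimpleGraph._~_ Γ u v → Joined u v
      adjacent⇒joined (_ , w , u∈ , v∈) = w , ∈⟨⟩⇒∈⟪⟫ (exponent w) u∈ , ∈⟨⟩⇒∈⟪⟫ (exponent w) v∈

    -- A set `D` with fewer than γ members is escaped by some `v`: if `v` were joined to a member,
    -- that member would be universal, yet it is a vertex of the proper graph.
    isDominationNumber : ∀ {γ} → 1 ≤ γ → Representatives γ → Escapes Universal γ →
                         IsDominationNumber (properEnhancedPowerGraph G) γ
    isDominationNumber {γ} 1≤γ reps escapes = record
      { attained = tabulate vertex
                 , ( Unique.tabulate⁺ (SimpleGraph.vertices proper) {f = vertex} rep-injective
                   , λ (v , _) v∉D → let i , joined = rep-covers v in
                       Any.tabulate⁺ {f = vertex} i (joined⇒adjacent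
                         (λ v≈rep → v∉D (Any.tabulate⁺ {f = vertex} i v≈rep))
                         (Joined-sym joined)) )
                 , length-tabulate vertex
      ; minimal  = minimal
      }
      where
      open Representatives reps
      proper = properEnhancedPowerGraph G
      open SimpleGraph proper using (Vertex)

      vertex : Fin γ → Vertex
      vertex i = rep i , λ dominating → rep-¬universal i (dominating⇒universal dominating)

      minimal : ∀ D → IsDominatingSet proper D → γ ≤ length D
      minimal [] (_ , dominates) with dominates (vertex (fromℕ< 1≤γ)) (λ ())
      ... | ()
      minimal D@(d₀ ∷ _) (_ , dominates) with γ ≤? length D
      ... | yes γ≤ = γ≤
      ... | no γ≰
        with v , avoid ← escapes (≰⇒> γ≰) (proj₁ ∘ lookup D)
        = contradiction
            (λ i → λ joined → proj₂ (lookup D i) (universal⇒dominating (avoid i joined)))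
            λ ¬joined →
              -- `v` is itself a vertex, since a dominating `v` would be joined to `d₀`. It is not
              -- in `D`, as it would be joined to itself, so it has to be adjacent to a member.
              let v∈proper = λ dominating → ¬joined zero (dominating⇒universal dominating (proj₁ d₀))
                  v~d = dominates (v , v∈proper) λ v∈D →
                          ¬joined (Any.index v∈D) (Joined-respʳ (Any.lookup-index v∈D) Joined-refl)
              in ¬joined (Any.index v~d) (adjacent⇒joined (Any.lookup-index v~d))

⋆-homo : ∀ {c₁ ℓ₁ c₂ ℓ₂} (G : Group c₁ ℓ₁) (H : Group c₂ ℓ₂) (φ : Group.Carrier G → Group.Carrier H) →
         let open Group H using (_≈_; _∙_)
             open Powers G using (_⋆_)
             open Powers H using () renaming (_⋆_ to _⋆ᴴ_) in
         φ (Group.ε G) ≈ Group.ε H → (∀ g h → φ (Group._∙_ G g h) ≈ φ g ∙ φ h) →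
         ∀ n g → φ (n ⋆ g) ≈ n ⋆ᴴ φ g
⋆-homo G H φ φ-ε φ-∙ zero    g = φ-ε
⋆-homo G H φ φ-ε φ-∙ (suc n) g = Group.trans H (φ-∙ g _) (Group.∙-congˡ H (⋆-homo G H φ φ-ε φ-∙ n g))

-- Direct products of two groups of coprime exponents

module Product {c₁ ℓ₁ c₂ ℓ₂} (A : Group c₁ ℓ₁) (B : Group c₂ ℓ₂) where
  private
    module A where
      open Group A public
      open Powers A public
      open Domination A public
    module B where
      open Group B public
      open Powers B public
      open Domination B public
    A×B = group A B
    module A×B where
      open Group A×B public
      open Powers A×B public
      open Domination A×B public

  ⋆-proj : ∀ n a b → (n A×B.⋆ (a , b)) A×B.≈ (n A.⋆ a , n B.⋆ b)
  ⋆-proj n a b = ⋆-homo A×B A proj₁ A.refl (λ _ _ → A.refl) n (a , b)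
               , ⋆-homo A×B B proj₂ B.refl (λ _ _ → B.refl) n (a , b)

  ∈⟪⟫-proj : ∀ {a b a′ b′} → (a , b) A×B.∈⟪ a′ , b′ ⟫ → a A.∈⟪ a′ ⟫ × b B.∈⟪ b′ ⟫
  ∈⟪⟫-proj {a′ = a′} {b′} (n , a≈ , b≈) =
    let pa , pb = ⋆-proj n a′ b′ in (n , A.trans a≈ pa) , (n , B.trans b≈ pb)

  Joined-proj : ∀ {a b a′ b′} → A×B.Joined (a , b) (a′ , b′) → A.Joined a a′ × B.Joined b b′
  Joined-proj ((wa , wb) , u∈ , v∈) =
    let a∈ , b∈ = ∈⟪⟫-proj u∈ ; a′∈ , b′∈ = ∈⟪⟫-proj v∈ in (wa , a∈ , a′∈) , (wb , b∈ , b′∈)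

  Exponent-× : ∀ {e f} → A.Exponent e → B.Exponent f → A×B.Exponent (e * f)
  Exponent-× {e} {f} eA fB (a , b) = let pa , pb = ⋆-proj (e * f) a b in
    A.trans pa (A.∣-⋆-vanishes {e} (m∣m*n f) (eA a)) , B.trans pb (B.∣-⋆-vanishes {f} (n∣m*n e) (fB b))

  module _ {e f} (e⊥f : Coprime e f) (eA : A.Exponent e) (fB : B.Exponent f) where

    ∈⟪⟫-× : ∀ {a b a′ b′} → a A.∈⟪ a′ ⟫ → b B.∈⟪ b′ ⟫ → (a , b) A×B.∈⟪ a′ , b′ ⟫
    ∈⟪⟫-× {a′ = a′} {b′} (s , a≈) (t , b≈) =
      let n , n≡s , n≡t = chinese-remainder e⊥f s t ; pa , pb = ⋆-proj n a′ b′ in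
      n , A.trans a≈ (A.trans (A.sym (A.⋆-mod n≡s (eA a′))) (A.sym pa))
        , B.trans b≈ (B.trans (B.sym (B.⋆-mod n≡t (fB b′))) (B.sym pb))

    Joined-× : ∀ {a b a′ b′} → A.Joined a a′ → B.Joined b b′ → A×B.Joined (a , b) (a′ , b′)
    Joined-× (wa , a∈ , a′∈) (wb , b∈ , b′∈) = (wa , wb) , ∈⟪⟫-× a∈ b∈ , ∈⟪⟫-× a′∈ b′∈

    Universal-× : ∀ {a b} → A.Universal a → B.Universal b → A×B.Universal (a , b)
    Universal-× ua ub (a′ , b′) = Joined-× (ua a′) (ub b′)

    -- If the pair is joined to `d i`, then both components are; hence both components of `d i` are
    -- universal, and so is `d i`.
    Escapes-× : ∀ {γ} → A.Escapes A.Universal γ → B.Escapes B.Universal γ → A×B.Escapes A×B.Universal γ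
    Escapes-× escA escB n<γ d =
      let va , avoidA = escA n<γ (proj₁ ∘ d) ; vb , avoidB = escB n<γ (proj₂ ∘ d) in
      (va , vb) , λ i joined →
        let ja , jb = Joined-proj joined in Universal-× (avoidA i ja) (avoidB i jb)

    Representatives-×ˡ : ∀ {γ} → A.Representatives γ → A×B.Representatives γ
    Representatives-×ˡ reps = record
      { rep            = λ i → rep i , B.ε
      ; rep-injective  = rep-injective ∘ proj₁
      ; rep-¬universal = λ i universal → rep-¬universal i λ a → proj₁ (Joined-proj (universal (a , B.ε)))
      ; rep-covers     = λ (a , b) → let i , joined = rep-covers a in i , Joined-× joined (B.ε-universal b)
      }
      where open A.Representatives reps

    Representatives-×ʳ : ∀ {γ} → B.Representatives γ → A×B.Representatives γ
    Representatives-×ʳ reps = record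
      { rep            = λ i → A.ε , rep i
      ; rep-injective  = rep-injective ∘ proj₂
      ; rep-¬universal = λ i universal → rep-¬universal i λ b → proj₂ (Joined-proj (universal (A.ε , b)))
      ; rep-covers     = λ (a , b) → let i , joined = rep-covers b in i , Joined-× (A.ε-universal a) joined
      }
      where open B.Representatives reps

cyclic⇒universal : ∀ (G : Group c ℓ) {e} .{{_ : NonZero e}} → Domination.Exponent G e →
                   IsCyclic G → ∀ u → Domination.Universal G u
cyclic⇒universal G exponent (w , generates) u v =
  w , ∈⟨⟩⇒∈⟪⟫ (exponent w) (generates u) , ∈⟨⟩⇒∈⟪⟫ (exponent w) (generates v)
  where open Powers G

-- Generalized quaternion groups

module Quaternion (Q : Group c ℓ) (k′ : ℕ) (isQuaternion : IsGeneralizedQuaternion Q (3 + k′)) where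
  open Group Q
  open Powers Q
  open Domination Q
  open IsGeneralizedQuaternion isQuaternion
  open Finite setoid order using (surjection⇒≤)
  open GroupProperties Q using (∙-cancelʳ)
  open SetoidReasoning setoid

  -- With k = 3 + k′, `n` = 2^(k-1) is the order of x and `h` = 2^(k-2) is half of it, which is also
  -- the number of subgroups ⟨ x^i y ⟩.
  h n : ℕ
  h = 2 ^ (1 + k′)
  n = 2 ^ (2 + k′)

  instance
    h≢0 : NonZero h
    h≢0 = m^n≢0 2 (1 + k′)
    n≢0 : NonZero n
    n≢0 = m^n≢0 2 (2 + k′)
    2n≢0 : NonZero (2 ^ (3 + k′))
    2n≢0 = m^n≢0 2 (3 + k′)

  1<h : 1 < h
  1<h = *-monoʳ-≤ 2 (>-nonZero⁻¹ (2 ^ k′) {{m^n≢0 2 k′}})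

  z : Carrier
  z = h ⋆ x

  private
    y∙y≈z : y ∙ y ≈ z
    y∙y≈z = trans (∙-congˡ (sym (identityʳ y))) (sym x-half-order)

    y-conjugates : y ∙ x ≈ (n ∸ 1) ⋆ x ∙ y
    y-conjugates = begin
      y ∙ x                      ≈⟨ identityʳ _ ⟨
      y ∙ x ∙ ε                  ≈⟨ ∙-congˡ (inverseˡ y) ⟨
      y ∙ x ∙ (y ⁻¹ ∙ y)         ≈⟨ assoc _ _ _ ⟨
      y ∙ x ∙ y ⁻¹ ∙ y           ≈⟨ ∙-congʳ conjugation ⟩
      x ⁻¹ ∙ y                   ≈⟨ ∙-congʳ (⁻¹-cong (1⋆ x)) ⟨
      (1 ⋆ x) ⁻¹ ∙ y             ≈⟨ ∙-congʳ (trans (⋆-⁻¹ 1 x-order) (⋆-congˡ (*-identityˡ (n ∸ 1)))) ⟩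
      (n ∸ 1) ⋆ x ∙ y      ∎

    y∙rotation : ∀ i → y ∙ i ⋆ x ≈ (i * (n ∸ 1)) ⋆ x ∙ y
    y∙rotation = conjugate-⋆ y-conjugates

    -- Since z = y², every power of z is a power of y.
    z-central : ∀ q → y ∙ q ⋆ z ≈ q ⋆ z ∙ y
    z-central q = begin
      y ∙ q ⋆ z          ≈⟨ ∙-congˡ qz≈ ⟩
      y ∙ (q * 2) ⋆ y    ≈⟨ ∙-⋆-comm y (q * 2) ⟩
      (q * 2) ⋆ y ∙ y    ≈⟨ ∙-congʳ qz≈ ⟨
      q ⋆ z ∙ y          ∎
      where
      qz≈ : q ⋆ z ≈ (q * 2) ⋆ y
      qz≈ = trans (⋆-congʳ q x-half-order) (⋆-⋆ y q 2)

    reflection∙z : ∀ i q → (i ⋆ x ∙ y) ∙ q ⋆ z ≈ (i + q * h) ⋆ x ∙ y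
    reflection∙z i q = begin
      i ⋆ x ∙ y ∙ q ⋆ z              ≈⟨ assoc _ _ _ ⟩
      i ⋆ x ∙ (y ∙ q ⋆ z)            ≈⟨ ∙-congˡ (z-central q) ⟩
      i ⋆ x ∙ (q ⋆ z ∙ y)            ≈⟨ assoc _ _ _ ⟨
      i ⋆ x ∙ q ⋆ z ∙ y              ≈⟨ ∙-congʳ (∙-congˡ (⋆-⋆ x q h)) ⟩
      i ⋆ x ∙ (q * h) ⋆ x ∙ y        ≈⟨ ∙-congʳ (⋆-+ x i (q * h)) ⟨
      (i + q * h) ⋆ x ∙ y            ∎

    reflection∙reflection : ∀ i j → (i ⋆ x ∙ y) ∙ (j ⋆ x ∙ y) ≈ (i + j * (n ∸ 1) + h) ⋆ x
    reflection∙reflection i j = begin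
      i ⋆ x ∙ y ∙ (j ⋆ x ∙ y)                          ≈⟨ assoc _ _ _ ⟨
      i ⋆ x ∙ y ∙ j ⋆ x ∙ y                            ≈⟨ ∙-congʳ (assoc _ _ _) ⟩
      i ⋆ x ∙ (y ∙ j ⋆ x) ∙ y                          ≈⟨ ∙-congʳ (∙-congˡ (y∙rotation j)) ⟩
      i ⋆ x ∙ (j′ ⋆ x ∙ y) ∙ y                         ≈⟨ ∙-congʳ (assoc _ _ _) ⟨
      i ⋆ x ∙ j′ ⋆ x ∙ y ∙ y                           ≈⟨ assoc _ _ _ ⟩
      i ⋆ x ∙ j′ ⋆ x ∙ (y ∙ y)                         ≈⟨ ∙-cong (sym (⋆-+ x i j′)) y∙y≈z ⟩
      (i + j′) ⋆ x ∙ h ⋆ x                             ≈⟨ ⋆-+ x (i + j′) h ⟨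
      (i + j′ + h) ⋆ x                                 ∎
      where j′ = j * (n ∸ 1)

    -- y inverts x, so x^i y x^i y collapses to y² = z.
    reflection² : ∀ i → 2 ⋆ (i ⋆ x ∙ y) ≈ z
    reflection² i = begin
      2 ⋆ (i ⋆ x ∙ y)                        ≈⟨ ∙-congˡ (identityʳ _) ⟩
      (i ⋆ x ∙ y) ∙ (i ⋆ x ∙ y)              ≈⟨ reflection∙reflection i i ⟩
      (i + i * (n ∸ 1) + h) ⋆ x        ≈⟨ ⋆-+ x (i + i * (n ∸ 1)) h ⟩
      (i + i * (n ∸ 1)) ⋆ x ∙ z        ≈⟨ ∙-congʳ (⋆-congˡ i+i[n-1]≡in) ⟩
      (i * n) ⋆ x ∙ z                        ≈⟨ ∙-congʳ (*-⋆-vanishes i x-order) ⟩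
      ε ∙ z                                  ≈⟨ identityˡ z ⟩
      z                                      ∎
      where
      i+i[n-1]≡in : i + i * (n ∸ 1) ≡ i * n
      i+i[n-1]≡in = ≡.trans (≡.sym (*-suc i (n ∸ 1))) (≡.cong (i *_) (suc-pred n))

  -- The two cosets of ⟨ x ⟩: rotations, and the elements x^i y, here called reflections.
  Shape : Carrier → Set ℓ
  Shape g = g ∈⟪ x ⟫ ⊎ ∃ λ i → g ≈ i ⋆ x ∙ y

  exponent : Exponent (2 ^ (3 + k′))
  exponent = Lagrange.order-⋆ Q order

  shape : ∀ g → Shape g
  shape g = generated-shape (generated g)
    where
    shape-∙ : ∀ {g g′} → Shape g → Shape g′ → Shape (g ∙ g′)
    shape-∙ (inj₁ g∈) (inj₁ g′∈) = inj₁ (∈⟪⟫-∙ g∈ g′∈)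
    shape-∙ (inj₁ (i , g≈)) (inj₂ (j , g′≈)) = inj₂
      (i + j , trans (∙-cong g≈ g′≈) (trans (sym (assoc _ _ _)) (∙-congʳ (sym (⋆-+ x i j)))))
    shape-∙ (inj₂ (i , g≈)) (inj₁ (j , g′≈)) = inj₂
      (i + j * (n ∸ 1) , trans (∙-cong g≈ g′≈) (trans (assoc _ _ _) (trans (∙-congˡ (y∙rotation j))
        (trans (sym (assoc _ _ _)) (∙-congʳ (sym (⋆-+ x i _)))))))
    shape-∙ (inj₂ (i , g≈)) (inj₂ (j , g′≈)) = inj₁
      (i + j * (n ∸ 1) + h , trans (∙-cong g≈ g′≈) (reflection∙reflection i j))

    shape-resp : ∀ {g g′} → g ≈ g′ → Shape g → Shape g′
    shape-resp g≈g′ (inj₁ g∈) = inj₁ (∈⟪⟫-resp g≈g′ g∈)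
    shape-resp g≈g′ (inj₂ (i , g≈)) = inj₂ (i , trans (sym g≈g′) g≈)

    shape-⋆ : ∀ {g} → Shape g → ∀ m → Shape (m ⋆ g)
    shape-⋆ _ zero    = inj₁ ε∈⟪⟫
    shape-⋆ s (suc m) = shape-∙ s (shape-⋆ s m)

    generated-shape : ∀ {g} → Generated Q (λ s → s ≈ x ⊎ s ≈ y) g → Shape g
    generated-shape (gen (inj₁ g≈x)) = inj₁ (∈⟪⟫-resp (sym g≈x) self∈⟪⟫)
    generated-shape (gen (inj₂ g≈y)) = inj₂ (0 , trans g≈y (sym (identityˡ y)))
    generated-shape unit             = inj₁ ε∈⟪⟫
    generated-shape (mul g g′)       = shape-∙ (generated-shape g) (generated-shape g′)
    -- By finiteness the inverse is a natural power, so closure under products covers it.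
    generated-shape (inv {g} gg)     = shape-resp
      (sym (trans (⁻¹-cong (sym (1⋆ g))) (⋆-⁻¹ 1 (exponent g))))
      (shape-⋆ (generated-shape gg) (1 * (2 ^ (3 + k′) ∸ 1)))
    generated-shape (resp g≈g′ g)    = shape-resp g≈g′ (generated-shape g)

  -- If x had smaller order, the two shapes would list fewer than 2n elements, yet Q has 2n.
  x-order-minimal : ∀ {i} → suc i < n → ¬ suc i ⋆ x ≈ ε
  x-order-minimal {i} i<n ix≈ε = <⇒≱ (+-mono-< i<n (≤-trans i<n (m≤m+n n 0))) (surjection⇒≤ f onto)
    where
    f : Fin (suc i + suc i) → Carrier
    f = [ (λ a → toℕ a ⋆ x) , (λ a → toℕ a ⋆ x ∙ y) ]′ ∘ splitAt (suc i)
    onto : ∀ g → ∃ λ a → g ≈ f a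
    onto g with shape g
    ... | inj₁ g∈ = let a , g≈ = ∈⟪⟫⇒Fin ix≈ε g∈ in
      a ↑ˡ suc i , trans g≈ (reflexive (≡.sym (≡.cong [ _ , _ ]′ (Fin.splitAt-↑ˡ (suc i) a (suc i)))))
    ... | inj₂ (j , g≈) = let a , jx≈ = ∈⟪⟫⇒Fin ix≈ε (⋆∈⟪⟫ j) in
      suc i ↑ʳ a , trans g≈ (trans (∙-congʳ jx≈)
        (reflexive (≡.sym (≡.cong [ _ , _ ]′ (Fin.splitAt-↑ʳ (suc i) (suc i) a)))))

  -- Otherwise every element of Q would be one of the n powers of x.
  y∉⟪x⟫ : ¬ y ∈⟪ x ⟫
  y∉⟪x⟫ y∈ = <⇒≱ (m<m+n n (≤-trans (>-nonZero⁻¹ n) (m≤m+n n 0)))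
    (surjection⇒≤ (λ (a : Fin n) → toℕ a ⋆ x) λ g → ∈⟪⟫⇒Fin x-order (in-x (shape g)))
    where
    in-x : ∀ {g} → Shape g → g ∈⟪ x ⟫
    in-x (inj₁ g∈)      = g∈
    in-x (inj₂ (i , g≈)) = ∈⟪⟫-resp (sym g≈) (∈⟪⟫-∙ (⋆∈⟪⟫ i) y∈)

  reflection∉⟪x⟫ : ∀ i → ¬ i ⋆ x ∙ y ∈⟪ x ⟫
  reflection∉⟪x⟫ i ∈x = y∉⟪x⟫ (∈⟪⟫-resp
    (trans (sym (assoc _ _ _)) (trans (∙-congʳ (inverseˡ (i ⋆ x))) (identityˡ y)))
    (∈⟪⟫-∙ (∈⟪⟫-⁻¹ x-order (⋆∈⟪⟫ i)) ∈x))

  -- Equal powers of x agree modulo its order n, a multiple of `h`. Multiplying a reflection by z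
  -- shifts its exponent by `h`, so only this residue can label subgroups.
  rotation-residue : ∀ i j → i ⋆ x ≈ j ⋆ x → i % h ≡ j % h
  rotation-residue i j eq = ≡.trans (≡.sym (m∣n⇒o%n%m≡o%m h n i (n∣m*n 2)))
    (≡.trans (≡.cong (_% h) i%n≡j%n) (m∣n⇒o%n%m≡o%m h n j (n∣m*n 2)))
    where
    i%n≡j%n : i % n ≡ j % n
    i%n≡j%n = ⋆-injective {d = n ∸ 1} (λ i< → x-order-minimal (≤-trans (s≤s i<) (≤-reflexive (suc-pred n))))
      (≤-pred (≤-trans (m%n<n i n) (≤-reflexive (≡.sym (suc-pred n)))))
      (≤-pred (≤-trans (m%n<n j n) (≤-reflexive (≡.sym (suc-pred n)))))
      (trans (sym (⋆-% i x-order)) (trans eq (⋆-% j x-order)))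

  ∈⟪reflection⟫ : ∀ {u} i → u ∈⟪ i ⋆ x ∙ y ⟫ → u ∈⟪ z ⟫ ⊎ ∃ λ q → u ≈ (i + q * h) ⋆ x ∙ y
  ∈⟪reflection⟫ {u} i (m , u≈) with m % 2 | m / 2 | m≡m%n+[m/n]*n m 2 | m%n<n m 2
  ... | zero | q | ≡.refl | _ = inj₁ (q , (begin
    u                              ≈⟨ u≈ ⟩
    (q * 2) ⋆ (i ⋆ x ∙ y)          ≈⟨ ⋆-⋆ _ q 2 ⟨
    q ⋆ 2 ⋆ (i ⋆ x ∙ y)            ≈⟨ ⋆-congʳ q (reflection² i) ⟩
    q ⋆ z                          ∎))
  ... | suc zero | q | ≡.refl | _ = inj₂ (q , (begin
    u                                        ≈⟨ u≈ ⟩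
    i ⋆ x ∙ y ∙ (q * 2) ⋆ (i ⋆ x ∙ y)        ≈⟨ ∙-congˡ (⋆-⋆ _ q 2) ⟨
    i ⋆ x ∙ y ∙ q ⋆ 2 ⋆ (i ⋆ x ∙ y)          ≈⟨ ∙-congˡ (⋆-congʳ q (reflection² i)) ⟩
    i ⋆ x ∙ y ∙ q ⋆ z                        ≈⟨ reflection∙z i q ⟩
    (i + q * h) ⋆ x ∙ y                      ∎))
  ... | suc (suc _) | _ | _ | s≤s (s≤s ())

  residue : ℕ → Fin h
  residue i = fromℕ< (m%n<n i h)

  -- 0 stands for ⟨ x ⟩ and 1 + r for ⟨ x^r y ⟩. Powers of z, which belong to all of these, receive
  -- 0; `joined-label` excepts them.
  label : Carrier → Fin (1 + h)
  label g = [ (λ _ → zero) , (λ (i , _) → suc (residue i)) ]′ (shape g)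

  rep : Fin (1 + h) → Carrier
  rep zero    = x
  rep (suc j) = toℕ j ⋆ x ∙ y

  label-rotation : ∀ {g} → g ∈⟪ x ⟫ → label g ≡ zero
  label-rotation {g} g∈ with shape g
  ... | inj₁ _ = ≡.refl
  ... | inj₂ (i , g≈) = contradiction (∈⟪⟫-resp g≈ g∈) (reflection∉⟪x⟫ i)

  label-reflection : ∀ {g} i → g ≈ i ⋆ x ∙ y → label g ≡ suc (residue i)
  label-reflection {g} i g≈ with shape g
  ... | inj₁ g∈ = contradiction (∈⟪⟫-resp g≈ g∈) (reflection∉⟪x⟫ i)
  ... | inj₂ (j , g≈′) = ≡.cong suc (Fin.fromℕ<-cong _ _
    (rotation-residue j i (∙-cancelʳ y _ _ (trans (sym g≈′) g≈))) _ _)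

  rep∉⟪z⟫ : ∀ j → ¬ rep j ∈⟪ z ⟫
  -- Otherwise 1 would be congruent to q h, hence to 0, modulo `h`, but `h` exceeds 1.
  rep∉⟪z⟫ zero (q , x≈) = contradiction
    (≡.trans (≡.sym (m<n⇒m%n≡m 1<h)) (≡.trans (rotation-residue 1 (q * h)
      (trans (1⋆ x) (trans x≈ (⋆-⋆ x q h)))) (m*n%n≡0 q h)))
    1+n≢0
  rep∉⟪z⟫ (suc j) ∈z = reflection∉⟪x⟫ (toℕ j) (∈⟪⟫-trans ∈z (⋆∈⟪⟫ h))

  -- The common cyclic group is generated by a rotation, leaving only ⟨ x ⟩, or by a reflection,
  -- whose powers are powers of z or reflections with the same residue modulo `h`.
  joined-label : ∀ j {g} → Joined (rep j) g → label g ≡ j ⊎ g ∈⟪ z ⟫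
  joined-label j {g} (w , rep∈ , g∈) with shape w
  joined-label zero {g} (w , rep∈ , g∈) | inj₁ w∈ = inj₁ (label-rotation (∈⟪⟫-trans g∈ w∈))
  joined-label (suc j) {g} (w , rep∈ , g∈) | inj₁ w∈ =
    contradiction (∈⟪⟫-trans rep∈ w∈) (reflection∉⟪x⟫ (toℕ j))
  ... | inj₂ (i , w≈)
    with ∈⟪reflection⟫ i (∈⟪⟫-trans rep∈ (1 , trans w≈ (sym (1⋆ _))))
       | ∈⟪reflection⟫ i (∈⟪⟫-trans g∈ (1 , trans w≈ (sym (1⋆ _))))
  ... | _ | inj₁ g∈z = inj₂ g∈z
  ... | inj₁ rep∈z | _ = contradiction rep∈z (rep∉⟪z⟫ j)
  joined-label zero _ | inj₂ (i , _) | inj₂ (q , x≈) | inj₂ _ =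
    contradiction (∈⟪⟫-resp x≈ self∈⟪⟫) (reflection∉⟪x⟫ (i + q * h))
  joined-label (suc j) _ | inj₂ (i , w≈) | inj₂ (q , rep≈) | inj₂ (r , g≈) =
    inj₁ (≡.trans (label-reflection (i + r * h) g≈) (≡.cong suc (Fin.toℕ-injective (≡.trans
      (Fin.toℕ-fromℕ< _) (≡.trans ([m+kn]%n≡m%n i r h) (≡.trans (≡.sym ([m+kn]%n≡m%n i q h))
        (≡.trans (≡.sym (rotation-residue (toℕ j) (i + q * h) (∙-cancelʳ y _ _ rep≈)))
          (m<n⇒m%n≡m (Fin.toℕ<n j)))))))))

  -- z is a power of x and the square of every reflection, so it lies in a common cyclic group with
  -- elements of either shape.
  z-universal : ∀ {g} → g ∈⟪ z ⟫ → Universal g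
  z-universal {g} g∈ v with shape v
  ... | inj₁ v∈ = x , ∈⟪⟫-trans g∈ (⋆∈⟪⟫ h) , v∈
  ... | inj₂ (i , v≈) = v , ∈⟪⟫-trans g∈ (2 , trans (sym (reflection² i)) (⋆-congʳ 2 (sym v≈))) , self∈⟪⟫

  label-rep : ∀ j → label (rep j) ≡ j
  label-rep j = [ id , (λ ∈z → contradiction ∈z (rep∉⟪z⟫ j)) ]′ (joined-label j Joined-refl)

  joined-reps : ∀ {i j} → Joined (rep i) (rep j) → i ≡ j
  joined-reps {i} {j} joined =
    [ (λ label≡i → ≡.trans (≡.sym label≡i) (label-rep j)) , (λ ∈z → contradiction ∈z (rep∉⟪z⟫ j)) ]′
      (joined-label i joined)

  representatives : Representatives (1 + h)
  representatives = record
    { rep            = rep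
    ; rep-injective  = λ eq → joined-reps (Joined-respʳ eq Joined-refl)
    ; rep-¬universal = ¬universal
    ; rep-covers     = covers
    }
    where
    ¬universal : ∀ j → ¬ Universal (rep j)
    ¬universal zero    universal = contradiction (joined-reps {zero} {suc (residue 0)} (universal _)) λ ()
    ¬universal (suc j) universal = contradiction (joined-reps {suc j} {zero} (universal _)) λ ()

    covers : ∀ g → ∃ λ j → Joined (rep j) g
    covers g with shape g
    ... | inj₁ g∈ = zero , x , self∈⟪⟫ , g∈
    -- Write i = r + q h with r the residue; multiplying the representative by z^q, a power of its
    -- square, gives g.
    ... | inj₂ (i , g≈) = suc (residue i) , rep (suc (residue i)) , self∈⟪⟫ , ∈⟪⟫-resp (begin
      (r ⋆ x ∙ y) ∙ q ⋆ 2 ⋆ (r ⋆ x ∙ y)   ≈⟨ ∙-congˡ (⋆-congʳ q (reflection² r)) ⟩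
      (r ⋆ x ∙ y) ∙ q ⋆ z                 ≈⟨ reflection∙z r q ⟩
      (r + q * h) ⋆ x ∙ y                 ≈⟨ ∙-congʳ (⋆-congˡ r+qh≡i) ⟩
      i ⋆ x ∙ y                           ≈⟨ g≈ ⟨
      g                                   ∎)
      (∈⟪⟫-∙ self∈⟪⟫ (∈⟪⟫-trans (⋆∈⟪⟫ q) (⋆∈⟪⟫ 2)))
      where
      q = i / h
      r = toℕ (residue i)
      r+qh≡i : r + q * h ≡ i
      r+qh≡i = ≡.trans (≡.cong (_+ q * h) (Fin.toℕ-fromℕ< _)) (≡.sym (m≡m%n+[m/n]*n i h))

  escapes : Escapes Universal (1 + h)
  escapes n< d = let j , unlabelled = missed n< (label ∘ d) in
    rep j , λ i joined → [ (λ eq → contradiction eq (unlabelled i)) , z-universal ]′ (joined-label j joined)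

-- Groups of prime power order

module _ (G : Group c ℓ) where
  open Group G

  upperCentral-resp : ∀ i {g h} → g ≈ h → upperCentral G i g → upperCentral G i h
  upperCentral-resp zero    g≈h (lift g≈ε) = lift (trans (sym g≈h) g≈ε)
  upperCentral-resp (suc i) g≈h g∈ k =
    upperCentral-resp i (∙-congʳ (∙-cong (∙-congʳ g≈h) (⁻¹-cong g≈h))) (g∈ k)

module PrimePower (G : Group c ℓ) {p} (p-prime : Prime p) {a} (order : HasOrder G (p ^ a)) where
  open Group G
  open Powers G
  open Domination G
  open Finite setoid order

  exponent : Exponent (p ^ a)
  exponent = Lagrange.order-⋆ G order

  instance
    p≢0 : NonZero p
    p≢0 = prime⇒nonZero p-prime

  HasOrderP : Carrier → Set ℓ
  HasOrderP g = ¬ g ≈ ε × p ⋆ g ≈ ε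

  private
    -- An annihilator of g that is prime to p would make g trivial.
    ∣-annihilator : ∀ {m g} → ¬ g ≈ ε → m ⋆ g ≈ ε → p ∣ m
    ∣-annihilator {m} {g} g≉ε mg≈ε = decidable-stable (p ∣? m) λ p∤m →
      g≉ε (coprime-vanishes (coprime-^ a (∤⇒coprime p-prime p∤m)) mg≈ε (exponent g))

  -- Induction on `e`: one factor p is extracted from `m`, and the quotient annihilates `p ⋆ g`.
  ^∣annihilator : ∀ e {m g} → ¬ p ^ e ⋆ g ≈ ε → m ⋆ g ≈ ε → p ^ suc e ∣ m
  ^∣annihilator zero {m} g≉ε mg≈ε =
    ≡.subst (_∣ m) (≡.sym (*-identityʳ p)) (∣-annihilator (λ g≈ε → g≉ε (trans (1⋆ _) g≈ε)) mg≈ε)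
  ^∣annihilator (suc e) {m} {g} pg≉ε mg≈ε = divide (∣-annihilator
    (λ g≈ε → pg≉ε (trans (⋆-congʳ (p ^ suc e) g≈ε) (⋆-ε (p ^ suc e)))) mg≈ε)
    where
    divide : p ∣ m → p ^ suc (suc e) ∣ m
    divide (divides q m≡) = ≡.subst (p ^ suc (suc e) ∣_) (≡.trans (*-comm p q) (≡.sym m≡)) (*-monoʳ-∣ p
      (^∣annihilator e {q} {p ⋆ g}
        (λ eq → pg≉ε (trans (⋆-congˡ (*-comm p (p ^ e))) (trans (sym (⋆-⋆ g (p ^ e) p)) eq)))
        (trans (⋆-⋆ g q p) (trans (⋆-congˡ (≡.sym m≡)) mg≈ε))))

  -- The last nontrivial term of g, g^p, g^(p²), ... has order p.
  socle-power : ∀ {g} → ¬ g ≈ ε → ∃ λ e → HasOrderP (p ^ e ⋆ g)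
  socle-power {g} g≉ε = last (least (λ e → (p ^ e ⋆ g) ≟ ε) a (exponent g))
    where
    last : (∃ λ e → p ^ e ⋆ g ≈ ε × (∀ {i} → i < e → ¬ p ^ i ⋆ g ≈ ε)) → ∃ λ e → HasOrderP (p ^ e ⋆ g)
    last (zero  , g≈ε , _)           = contradiction (trans (sym (1⋆ g)) g≈ε) g≉ε
    last (suc e , vanishes , minimal) = e , minimal (n<1+n e) , trans (⋆-⋆ g p (p ^ e)) vanishes

  private
    -- If v = w^m is killed by p, then p^(e+1) divides p m, so p^e divides m.
    ∈⟪socle⟫ : ∀ {e v w} → HasOrderP (p ^ e ⋆ w) → p ⋆ v ≈ ε → v ∈⟪ w ⟫ → v ∈⟪ p ^ e ⋆ w ⟫
    ∈⟪socle⟫ {e} {v} {w} (u≉ε , _) pv≈ε (m , v≈) = divide (*-cancelˡ-∣ p (^∣annihilator e u≉ε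
      (trans (sym (⋆-⋆ w p m)) (trans (⋆-congʳ p (sym v≈)) pv≈ε))))
      where
      divide : p ^ e ∣ m → v ∈⟪ p ^ e ⋆ w ⟫
      divide (divides b m≡) = b , trans v≈ (trans (⋆-congˡ m≡) (sym (⋆-⋆ w b (p ^ e))))

  -- h is u^b with b prime to p, and b can be inverted modulo p.
  order-p-sym : ∀ {h u} → HasOrderP h → p ⋆ u ≈ ε → h ∈⟪ u ⟫ → u ∈⟪ h ⟫
  order-p-sym (h≉ε , _) pu≈ε (b , h≈) =
    let s , sbu≈u = ⋆-inverse {a = b} (∤⇒coprime p-prime λ p∣b →
          h≉ε (trans h≈ (∣-⋆-vanishes p∣b pu≈ε))) pu≈ε
    in s , trans (sym sbu≈u) (⋆-congʳ s (sym h≈))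

  -- The last nontrivial p-power of w generates a subgroup containing both t and h, and is in turn a
  -- power of h.
  order-p-unique : ∀ {t h w} → HasOrderP t → HasOrderP h → t ∈⟪ w ⟫ → h ∈⟪ w ⟫ → t ∈⟪ h ⟫
  order-p-unique (t≉ε , pt≈ε) h-order@(h≉ε , ph≈ε) t∈@(m , t≈) h∈ =
    let e , u-order = socle-power λ w≈ε → t≉ε (trans t≈ (trans (⋆-congʳ m w≈ε) (⋆-ε m)))
    in ∈⟪⟫-trans (∈⟪socle⟫ {e} u-order pt≈ε t∈)
         (order-p-sym h-order (proj₂ u-order) (∈⟪socle⟫ {e} u-order ph≈ε h∈))

-- Two subgroups of order p in a noncyclic p-group, p odd

module Noncyclic (G : Group c ℓ) {p} (p-prime : Prime p) (2∤p : ¬ 2 ∣ p) {a} (order : HasOrder G (p ^ a))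
                 (nilpotent : IsNilpotent G) (¬cyclic : ¬ IsCyclic G) where
  open Group G
  open Powers G
  open Domination G
  open Finite setoid order using (_≟_; all?; ¬∀⇒∃¬)
  open PrimePower G p-prime {a} order
  open SetoidReasoning setoid

  private
    instance
      p^a≢0 : NonZero (p ^ a)
      p^a≢0 = m^n≢0 p a

    ∈⟪_⟫?_ : ∀ g u → Dec (u ∈⟪ g ⟫)
    ∈⟪ g ⟫? u = ∈⟪⟫? {p ^ a} _≟_ u g (exponent g)

    Normalizes : Carrier → Carrier → Set ℓ
    Normalizes g y = ∃ λ s → y ∙ g ≈ s ⋆ g ∙ y

    normalizes-⋆ : ∀ {g y} m → Normalizes g y → Normalizes g (m ⋆ y)
    normalizes-⋆ {g} {y} zero    _ = 1 , trans (identityˡ g) (sym (trans (identityʳ _) (1⋆ g)))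
    normalizes-⋆ {g} {y} (suc m) norm@(s , yg≈) with s′ , myg≈ ← normalizes-⋆ m norm = s′ * s , (begin
      y ∙ m ⋆ y ∙ g              ≈⟨ assoc _ _ _ ⟩
      y ∙ (m ⋆ y ∙ g)            ≈⟨ ∙-congˡ myg≈ ⟩
      y ∙ (s′ ⋆ g ∙ m ⋆ y)       ≈⟨ assoc _ _ _ ⟨
      y ∙ s′ ⋆ g ∙ m ⋆ y         ≈⟨ ∙-congʳ (conjugate-⋆ yg≈ s′) ⟩
      (s′ * s) ⋆ g ∙ y ∙ m ⋆ y   ≈⟨ assoc _ _ _ ⟩
      (s′ * s) ⋆ g ∙ (y ∙ m ⋆ y) ∎)

    -- Normalizers grow: a commutator with g either lies in ⟨ g ⟩, or is an
    -- element outside ⟨ g ⟩ that is lower in the central series.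
    normalizer-grows : ∀ i {g u} → upperCentral G i u → ¬ u ∈⟪ g ⟫ → ∃ λ y → ¬ y ∈⟪ g ⟫ × Normalizes g y
    normalizer-grows zero    (lift u≈ε) u∉ = contradiction (∈⟪⟫-resp (sym u≈ε) ε∈⟪⟫) u∉
    normalizer-grows (suc i) {g} {u} u∈ u∉ with ∈⟪ g ⟫? (u ∙ g ∙ u ⁻¹ ∙ g ⁻¹)
    ... | no  v∉ = normalizer-grows i (u∈ g) v∉
    ... | yes v∈ with s , ugu⁻¹≈ ← ∈⟪⟫-resp (trans (assoc _ _ _) (trans (∙-congˡ (inverseˡ g))
                                                                        (identityʳ _)))
                                      (∈⟪⟫-∙ v∈ self∈⟪⟫) =
      u , u∉ , s , (begin
        u ∙ g                    ≈⟨ identityʳ _ ⟨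
        u ∙ g ∙ ε                ≈⟨ ∙-congˡ (inverseˡ u) ⟨
        u ∙ g ∙ (u ⁻¹ ∙ u)       ≈⟨ assoc _ _ _ ⟨
        u ∙ g ∙ u ⁻¹ ∙ u         ≈⟨ ∙-congʳ ugu⁻¹≈ ⟩
        s ⋆ g ∙ u                ∎)

    -- Pass from y to y^p until the next p-th power falls into ⟨ g ⟩; every power of y still
    -- normalizes ⟨ g ⟩.
    last-outside : ∀ j {g y} → ¬ y ∈⟪ g ⟫ → Normalizes g y → p ^ j ⋆ y ∈⟪ g ⟫ →
                   ∃ λ y → ¬ y ∈⟪ g ⟫ × Normalizes g y × p ⋆ y ∈⟪ g ⟫
    last-outside zero y∉ _ y∈ = contradiction (∈⟪⟫-resp (1⋆ _) y∈) y∉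
    last-outside (suc j) {g} {y} y∉ norm py∈ with ∈⟪ g ⟫? (p ⋆ y)
    ... | yes y∈ = y , y∉ , norm , y∈
    ... | no  y∉ = last-outside j y∉ (normalizes-⋆ p norm)
      (∈⟪⟫-resp (sym (trans (⋆-⋆ y (p ^ j) p) (⋆-congˡ (*-comm (p ^ j) p)))) py∈)

    module _ {g y s} (yg≈ : y ∙ g ≈ s ⋆ g ∙ y) where

      -- Stands for 1 - s modulo p^a, with p^a - 1 in place of -1.
      d = 1 + s * (p ^ a ∸ 1)

      commutator : ∀ m → m ⋆ g ∙ y ∙ (m ⋆ g) ⁻¹ ∙ y ⁻¹ ≈ (d * m) ⋆ g
      commutator m = begin
        m ⋆ g ∙ y ∙ (m ⋆ g) ⁻¹ ∙ y ⁻¹              ≈⟨ ∙-congʳ (∙-congˡ (⋆-⁻¹ {p ^ a} m (exponent g))) ⟩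
        m ⋆ g ∙ y ∙ m′ ⋆ g ∙ y ⁻¹                  ≈⟨ ∙-congʳ (assoc _ _ _) ⟩
        m ⋆ g ∙ (y ∙ m′ ⋆ g) ∙ y ⁻¹                ≈⟨ ∙-congʳ (∙-congˡ (conjugate-⋆ yg≈ m′)) ⟩
        m ⋆ g ∙ ((m′ * s) ⋆ g ∙ y) ∙ y ⁻¹          ≈⟨ ∙-congʳ (assoc _ _ _) ⟨
        m ⋆ g ∙ (m′ * s) ⋆ g ∙ y ∙ y ⁻¹            ≈⟨ assoc _ _ _ ⟩
        m ⋆ g ∙ (m′ * s) ⋆ g ∙ (y ∙ y ⁻¹)          ≈⟨ trans (∙-congˡ (inverseʳ y)) (identityʳ _) ⟩
        m ⋆ g ∙ (m′ * s) ⋆ g                       ≈⟨ ⋆-+ g m (m′ * s) ⟨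
        (m + m′ * s) ⋆ g                           ≈⟨ ⋆-congˡ (shape m (p ^ a ∸ 1) s) ⟩
        (d * m) ⋆ g                                ∎
        where
        m′ = m * (p ^ a ∸ 1)
        shape : ∀ m q s → m + m * q * s ≡ (1 + s * q) * m
        shape = solve-∀

      -- Each commutator with y multiplies the exponent of g by `d` and descends one step in the
      -- central series.
      iterated-commutator : ∀ i m → upperCentral G i (m ⋆ g) → ∃ λ j → (d ^ j * m) ⋆ g ≈ ε
      iterated-commutator zero    m (lift mg≈ε) = 0 , trans (⋆-congˡ (*-identityˡ m)) mg≈ε
      iterated-commutator (suc i) m mg∈
        with j , eq ← iterated-commutator i (d * m) (upperCentral-resp G i (commutator m) (mg∈ y)) =
        suc j , trans (⋆-congˡ (≡.trans (≡.cong (_* m) (*-comm d (d ^ j))) (*-assoc (d ^ j) d m))) eq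

      -- Nilpotency makes a power of `d` annihilate g, so p divides that power and hence `d`, the
      -- stand-in for 1 - s.
      conjugation-exponent : ¬ g ≈ ε → p ∣ p ^ a → ∃ λ v → s ≡ 1 + v * p
      conjugation-exponent g≉ε p∣q = s≡1 s ≡.refl
        where
        p∣d : p ∣ d
        p∣d = let j , eq = iterated-commutator (proj₁ nilpotent) 1 (proj₂ nilpotent (1 ⋆ g)) in
          ∣^⇒∣ p-prime d j (≡.subst (p ∣_) (*-identityʳ (d ^ j)) (≡.subst (_∣ d ^ j * 1) (*-identityʳ p)
            (^∣annihilator 0 (λ g≈ε → g≉ε (trans (sym (1⋆ g)) g≈ε)) eq)))
        -- Since s p^a = d + (s - 1) and p divides both s p^a and d, it divides s - 1.
        sq≡d+s′ : ∀ s′ → suc s′ * p ^ a ≡ 1 + suc s′ * (p ^ a ∸ 1) + s′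
        sq≡d+s′ s′ = ≡.trans (≡.cong (suc s′ *_) (≡.sym (suc-pred (p ^ a)))) (shape s′ (p ^ a ∸ 1))
          where
          shape : ∀ s q → (1 + s) * (1 + q) ≡ 1 + (1 + s) * q + s
          shape = solve-∀
        s≡1 : ∀ s′ → s ≡ s′ → ∃ λ v → s′ ≡ 1 + v * p
        -- s = 0 would give d = 1, which p does not divide.
        s≡1 zero ≡.refl = contradiction (∣1⇒≡1 p∣d) (nonTrivial⇒≢1 {{prime⇒nonTrivial p-prime}})
        s≡1 (suc s′) ≡.refl
          with divides v ≡.refl ← ∣m+n∣m⇒∣n (≡.subst (p ∣_) (sq≡d+s′ s′) (∣n⇒∣m*n (suc s′) p∣q)) p∣d =
          v , ≡.refl

      -- The leading y is moved past the collected power of g, multiplying its exponent by s; this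
      -- is the recursion of `geometric`.
      ⋆-product : ∀ b n → n ⋆ (b ⋆ g ∙ y) ≈ (b * geometric s n) ⋆ g ∙ n ⋆ y
      ⋆-product b zero    = sym (trans (identityʳ _) (⋆-congˡ (*-zeroʳ b)))
      ⋆-product b (suc n) = begin
        b ⋆ g ∙ y ∙ n ⋆ (b ⋆ g ∙ y)                    ≈⟨ ∙-congˡ (⋆-product b n) ⟩
        b ⋆ g ∙ y ∙ (bS ⋆ g ∙ n ⋆ y)                   ≈⟨ assoc _ _ _ ⟨
        b ⋆ g ∙ y ∙ bS ⋆ g ∙ n ⋆ y                     ≈⟨ ∙-congʳ (assoc _ _ _) ⟩
        b ⋆ g ∙ (y ∙ bS ⋆ g) ∙ n ⋆ y                   ≈⟨ ∙-congʳ (∙-congˡ (conjugate-⋆ yg≈ bS)) ⟩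
        b ⋆ g ∙ ((bS * s) ⋆ g ∙ y) ∙ n ⋆ y             ≈⟨ ∙-congʳ (assoc _ _ _) ⟨
        b ⋆ g ∙ (bS * s) ⋆ g ∙ y ∙ n ⋆ y               ≈⟨ assoc _ _ _ ⟩
        b ⋆ g ∙ (bS * s) ⋆ g ∙ (y ∙ n ⋆ y)             ≈⟨ ∙-congʳ (⋆-+ g b (bS * s)) ⟨
        (b + bS * s) ⋆ g ∙ suc n ⋆ y                   ≈⟨ ∙-congʳ (⋆-congˡ (shape b (geometric s n) s)) ⟩
        (b * geometric s (suc n)) ⋆ g ∙ suc n ⋆ y      ∎
        where
        bS = b * geometric s n
        shape : ∀ b S s → b + b * S * s ≡ b * (1 + s * S)
        shape = solve-∀

    -- With s = 1 + v p, the p-th power of g ^ b ∙ y is g ^ (b S) ∙ y ^ p where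
    -- S = p (1 + X p); since p divides t, a suitable b kills it.
    correction : ∀ e {g y s t} → p ^ suc e ⋆ g ≈ ε → p ^ suc e ⋆ y ≈ ε → ¬ p ^ e ⋆ g ≈ ε → ¬ y ∈⟪ g ⟫ →
                 y ∙ g ≈ s ⋆ g ∙ y → (∃ λ v → s ≡ 1 + v * p) → p ⋆ y ≈ t ⋆ g →
                 ∃ λ w → HasOrderP w × ¬ w ∈⟪ g ⟫
    correction e {g} {y} {s} {t} qg≈ε qy≈ε g-order y∉ yg≈ (v , ≡.refl) py≈
      -- p^(e+1) kills y, so p^e t kills g; hence p^(e+1) divides p^e t, and p divides t.
      with divides t′ ≡.refl ← *-cancelˡ-∣ {p} {t} (p ^ e) {{m^n≢0 p e}}
             (≡.subst (_∣ p ^ e * t) (*-comm p (p ^ e))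
             (^∣annihilator e g-order (begin
               (p ^ e * t) ⋆ g     ≈⟨ ⋆-⋆ g (p ^ e) t ⟨
               p ^ e ⋆ t ⋆ g       ≈⟨ ⋆-congʳ (p ^ e) py≈ ⟨
               p ^ e ⋆ p ⋆ y       ≈⟨ ⋆-⋆ y (p ^ e) p ⟩
               (p ^ e * p) ⋆ y     ≈⟨ ⋆-congˡ (*-comm (p ^ e) p) ⟩
               p ^ suc e ⋆ y       ≈⟨ qy≈ε ⟩
               ε                   ∎)))
         | X , S≡ ← geometric-odd v 2∤p = w , ((λ w≈ε → w∉ (∈⟪⟫-resp (sym w≈ε) ε∈⟪⟫)) , pw≈ε) , w∉
      where
      q = p ^ suc e
      instance
        q≢0 : NonZero q
        q≢0 = m^n≢0 p (suc e)
      S′ = 1 + X * p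
      C = p * (t′ * (q ∸ 1))
      S′⊥q : Coprime S′ q
      S′⊥q = coprime-^ (suc e) λ {i} (i∣ , i∣p) →
        ∣1⇒≡1 (∣m+n∣m⇒∣n (≡.subst (i ∣_) (+-comm 1 (X * p)) i∣) (∣n⇒∣m*n X i∣p))
      σ = proj₁ (⋆-inverse {x = g} S′⊥q qg≈ε)
      σS′g≈g : σ ⋆ S′ ⋆ g ≈ g
      σS′g≈g = proj₂ (⋆-inverse {x = g} S′⊥q qg≈ε)
      -- `q ∸ 1` stands for -1 modulo q and σ inverts S′ on g, so g^(b S′ p) is the inverse of y^p =
      -- g^(t′ p).
      b = t′ * (q ∸ 1) * σ
      w = b ⋆ g ∙ y
      w∉ : ¬ w ∈⟪ g ⟫
      w∉ w∈ = y∉ (∈⟪⟫-resp (trans (sym (assoc _ _ _)) (trans (∙-congʳ (inverseˡ (b ⋆ g))) (identityˡ y)))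
        (∈⟪⟫-∙ (∈⟪⟫-⁻¹ {e = q} qg≈ε (⋆∈⟪⟫ b)) w∈))
      pw≈ε : p ⋆ w ≈ ε
      pw≈ε = begin
        p ⋆ w                                              ≈⟨ ⋆-product yg≈ b p ⟩
        (b * geometric (1 + v * p) p) ⋆ g ∙ p ⋆ y          ≈⟨ ∙-cong (⋆-congˡ (≡.cong (b *_) S≡)) py≈ ⟩
        (b * (S′ * p)) ⋆ g ∙ (t′ * p) ⋆ g                  ≈⟨ ∙-congʳ (⋆-congˡ (regroup (t′ * (q ∸ 1)) σ S′ p)) ⟩
        (C * (σ * S′)) ⋆ g ∙ (t′ * p) ⋆ g                  ≈⟨ ∙-congʳ (⋆-⋆ g C (σ * S′)) ⟨
        C ⋆ (σ * S′) ⋆ g ∙ (t′ * p) ⋆ g                    ≈⟨ ∙-congʳ (⋆-congʳ C (⋆-⋆ g σ S′)) ⟨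
        C ⋆ σ ⋆ S′ ⋆ g ∙ (t′ * p) ⋆ g                      ≈⟨ ∙-congʳ (⋆-congʳ C σS′g≈g) ⟩
        C ⋆ g ∙ (t′ * p) ⋆ g                               ≈⟨ ⋆-+ g C (t′ * p) ⟨
        (C + t′ * p) ⋆ g                                   ≈⟨ ⋆-congˡ (collect p t′ (q ∸ 1)) ⟩
        (t′ * p * (1 + (q ∸ 1))) ⋆ g                       ≈⟨ ⋆-congˡ (≡.cong (t′ * p *_) (suc-pred q)) ⟩
        (t′ * p * q) ⋆ g                                   ≈⟨ *-⋆-vanishes (t′ * p) qg≈ε ⟩
        ε                                                  ∎
        where
        regroup : ∀ c σ X p → c * σ * (X * p) ≡ p * c * (σ * X)
        regroup = solve-∀
        collect : ∀ p t q → p * (t * q) + t * p ≡ t * p * (1 + q)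
        collect = solve-∀

  -- Choosing g of maximal order p^(e+1) ensures that p^(e+1) kills y too, which `correction` needs.
  two-subgroups : ∃₂ λ g w → HasOrderP g × HasOrderP w × ¬ w ∈⟪ g ⟫
  two-subgroups
    with least (λ e → all? {P = λ g → p ^ e ⋆ g ≈ ε} (λ x≈y → trans (⋆-congʳ (p ^ e) (sym x≈y)))
                           (λ g → (p ^ e ⋆ g) ≟ ε))
               a exponent
  -- Exponent 1: the group is trivial, hence cyclic.
  ... | zero  , trivial , _ = contradiction (ε , λ u → ℤ.+ 0 , trans (sym (1⋆ u)) (trivial u)) ¬cyclic
  ... | suc e , q-exponent , minimal
    with g , g-order ← ¬∀⇒∃¬ {P = λ g → p ^ e ⋆ g ≈ ε} (λ x≈y → trans (⋆-congʳ (p ^ e) (sym x≈y)))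
                             (λ g → (p ^ e ⋆ g) ≟ ε) (minimal (n<1+n e))
    with u , u∉ ← ¬∀⇒∃¬ {P = _∈⟪ g ⟫} ∈⟪⟫-resp (∈⟪ g ⟫?_) (λ generates → ¬cyclic (g , ∈⟪⟫⇒∈⟨⟩ ∘ generates))
    with y₀ , y₀∉ , norm₀ ← normalizer-grows (proj₁ nilpotent) (proj₂ nilpotent u) u∉
    with y , y∉ , (s , yg≈) , t , py≈ ← last-outside (suc e) y₀∉ norm₀ (∈⟪⟫-resp (sym (q-exponent y₀)) ε∈⟪⟫)
    with w , w-order , w∉ ← correction e {s = s} {t} (q-exponent g) (q-exponent y) g-order y∉ yg≈
           (conjugation-exponent {s = s} yg≈ (λ g≈ε → g-order (trans (⋆-congʳ (p ^ e) g≈ε) (⋆-ε (p ^ e))))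
             (∣-trans (m∣m*n (p ^ e)) (^∣annihilator e g-order (exponent g)))) py≈ =
    p ^ e ⋆ g , w , (g-order , trans (⋆-⋆ g p (p ^ e)) (q-exponent g)) , w-order ,
    λ w∈ → w∉ (∈⟪⟫-trans w∈ (⋆∈⟪⟫ (p ^ e)))

-- Subgroups of order p as labels

module OrderPSubgroups (G : Group c ℓ) {p} (p-prime : Prime p) {a} (order : HasOrder G (p ^ a))
                       {r} (card : HasCardinality (subgroupsOfOrder G p) r) where
  open Group G
  open Powers G
  open Domination G
  open Finite setoid order using (_≟_)
  open PrimePower G p-prime {a} order
  private
    module Subgroups = Finite (subgroupsOfOrder G p) card

    1<p : 1 < p
    1<p = nonTrivial⇒n>1 p {{prime⇒nonTrivial p-prime}}

    p^a≢0 : NonZero (p ^ a)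
    p^a≢0 = m^n≢0 p a

  ⋆-injective-p : ∀ {t} → HasOrderP t → ∀ (i j : Fin p) → toℕ i ⋆ t ≈ toℕ j ⋆ t → i ≡ j
  ⋆-injective-p {t} (t≉ε , pt≈ε) i j eq = Fin.toℕ-injective (⋆-injective {d = pred p} minimal
    (<⇒≤pred (Fin.toℕ<n i)) (<⇒≤pred (Fin.toℕ<n j)) eq)
    where
    minimal : ∀ {i} → i < pred p → ¬ suc i ⋆ t ≈ ε
    minimal {i} i<p-1 it≈ε = <⇒≱ (≤-trans (s≤s i<p-1) (≤-reflexive (suc-pred p)))
      (∣⇒≤ (≡.subst (_∣ suc i) (*-identityʳ p)
        (^∣annihilator 0 (λ t≈ε → t≉ε (trans (sym (1⋆ t)) t≈ε)) it≈ε)))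

  OrderPSubgroup : Set _
  OrderPSubgroup = Setoid.Carrier (subgroupsOfOrder G p)

  cyclicSubgroup : ∀ t → HasOrderP t → OrderPSubgroup
  cyclicSubgroup t t-order@(_ , pt≈ε) = H , record
    { to        = λ (_ , u∈) → proj₁ (∈⟪⟫⇒Fin pt≈ε u∈)
    ; from      = λ i → toℕ i ⋆ t , ⋆∈⟪⟫ (toℕ i)
    ; to-cong   = λ {(u , u∈)} {(v , v∈)} u≈v → ⋆-injective-p t-order _ _
        (trans (sym (proj₂ (∈⟪⟫⇒Fin pt≈ε u∈))) (trans u≈v (proj₂ (∈⟪⟫⇒Fin pt≈ε v∈))))
    ; from-cong = λ i≡j → ⋆-congˡ (≡.cong toℕ i≡j)
    ; inverse   = (λ {i} {(u , u∈)} u≈ → ⋆-injective-p t-order _ _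
                    (trans (sym (proj₂ (∈⟪⟫⇒Fin pt≈ε u∈))) u≈))
                , (λ {(u , u∈)} {i} i≡ → trans (⋆-congˡ (≡.cong toℕ i≡)) (sym (proj₂ (∈⟪⟫⇒Fin pt≈ε u∈))))
    }
    where
    H : Subgroup G
    H = record
      { member    = _∈⟪ t ⟫
      ; respects  = ∈⟪⟫-resp
      ; ε-closed  = ε∈⟪⟫
      ; ∙-closed  = ∈⟪⟫-∙
      ; ⁻¹-closed = ∈⟪⟫-⁻¹ pt≈ε
      }

  index : ∀ t → HasOrderP t → Fin r
  index t t-order = Subgroups.to (cyclicSubgroup t t-order)

  index-cong : ∀ {t u} (t-order : HasOrderP t) (u-order : HasOrderP u) → t ∈⟪ u ⟫ → u ∈⟪ t ⟫ →
               index t t-order ≡ index u u-order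
  index-cong t-order u-order t∈ u∈ =
    Subgroups.to-cong {cyclicSubgroup _ t-order} {cyclicSubgroup _ u-order}
      ((λ v∈ → ∈⟪⟫-trans v∈ t∈) , (λ v∈ → ∈⟪⟫-trans v∈ u∈))

  index-injective : ∀ {t u} (t-order : HasOrderP t) (u-order : HasOrderP u) →
                    index t t-order ≡ index u u-order → t ∈⟪ u ⟫
  index-injective t-order u-order eq =
    proj₁ (Subgroups.to-injective {cyclicSubgroup _ t-order} {cyclicSubgroup _ u-order} eq) self∈⟪⟫

  module Generator (K : OrderPSubgroup) where
    open Subgroup (proj₁ K)
    private
      module H = Finite (subsetoid setoid member) (proj₂ K)

      element : Fin p → Carrier
      element = proj₁ ∘ H.from

      nontrivial : ∃ λ i → ¬ element i ≈ ε
      -- Elements 0 and 1 of the enumeration are distinct, so one of them is not the identity.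
      nontrivial with element (fromℕ< (<-trans z<s 1<p)) ≟ ε
      ... | no ≉ε = _ , ≉ε
      ... | yes ≈ε = fromℕ< 1<p , λ one≈ε → contradiction
        (≡.trans (≡.sym (Fin.toℕ-fromℕ< (<-trans z<s 1<p)))
          (≡.trans (≡.cong toℕ (H.from-injective (trans ≈ε (sym one≈ε)))) (Fin.toℕ-fromℕ< 1<p))) λ ()

    generator : Carrier
    generator = element (proj₁ nontrivial)

    generator∈ : member generator
    generator∈ = proj₂ (H.from (proj₁ nontrivial))

    generator-order : HasOrderP generator
    generator-order = proj₂ nontrivial , trans (⋆-congˡ (≡.sym (length-tabulate element)))
      (Lagrange.length-⋆ G order generator (tabulate element)
        (Unique.tabulate⁺ setoid {f = element} H.from-injective) λ {u} u∈ →
          let i , u≈ = ∈ₚ.∈-tabulate⁻ setoid {f = element} u∈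
              gu∈ = ∙-closed generator∈ (respects (sym u≈) (proj₂ (H.from i)))
          in ∈ₚ.∈-resp-≈ setoid (H.from-to (_ , gu∈))
               (∈ₚ.∈-tabulate⁺ setoid {f = element} (H.to (_ , gu∈))))

    ⟪generator⟫⊆ : ∀ {u} → u ∈⟪ generator ⟫ → member u
    ⟪generator⟫⊆ (n , u≈) = respects (sym u≈) (⋆∈ n)
      where
      ⋆∈ : ∀ n → member (n ⋆ generator)
      ⋆∈ zero    = ε-closed
      ⋆∈ (suc n) = ∙-closed generator∈ (⋆∈ n)

    -- Otherwise u and the p powers of the generator are p + 1 elements of H.
    ⊆⟪generator⟫ : ∀ {u} → member u → u ∈⟪ generator ⟫
    ⊆⟪generator⟫ {u} u∈ = decidable-stable (∈⟪⟫? {p} _≟_ u generator (proj₂ generator-order)) λ u∉ →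
      1+n≰n (Fin.injective⇒≤ (f-injective u∉))
      where
      power∈ : ∀ i → member (toℕ i ⋆ generator)
      power∈ i = ⟪generator⟫⊆ (⋆∈⟪⟫ (toℕ i))
      f : Fin (suc p) → Fin p
      f zero    = H.to (u , u∈)
      f (suc i) = H.to (_ , power∈ i)
      f-injective : ¬ u ∈⟪ generator ⟫ → ∀ {i j} → f i ≡ f j → i ≡ j
      f-injective u∉ {zero}  {zero}  _  = ≡.refl
      f-injective u∉ {zero}  {suc j} eq = contradiction (toℕ j , H.to-injective eq) u∉
      f-injective u∉ {suc i} {zero}  eq = contradiction (toℕ i , sym (H.to-injective eq)) u∉
      f-injective u∉ {suc i} {suc j} eq = ≡.cong suc (⋆-injective-p generator-order i j (H.to-injective eq))

  rep : Fin r → Carrier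
  rep i = Generator.generator (Subgroups.from i)

  rep-order : ∀ i → HasOrderP (rep i)
  rep-order i = Generator.generator-order (Subgroups.from i)

  index-rep : ∀ i → index (rep i) (rep-order i) ≡ i
  index-rep i = ≡.trans
    (Subgroups.to-cong {cyclicSubgroup _ (rep-order i)} {Subgroups.from i}
      (Generator.⟪generator⟫⊆ (Subgroups.from i) , Generator.⊆⟪generator⟫ (Subgroups.from i)))
    (Subgroups.to-from i)

  -- The cyclic group ⟨ w ⟩ has only one subgroup of order p, and both t and u generate it.
  index-joined : ∀ {t u} (t-order : HasOrderP t) (u-order : HasOrderP u) → Joined t u →
                 index t t-order ≡ index u u-order
  index-joined t-order u-order (w , t∈ , u∈) = index-cong t-order u-order
    (order-p-unique t-order u-order t∈ u∈) (order-p-unique u-order t-order u∈ t∈)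

  private
    ⟪⟫-joined : ∀ {t g u} → u ∈⟪ g ⟫ → Joined t g → Joined t u
    ⟪⟫-joined u∈g (w , t∈ , g∈) = w , t∈ , ∈⟪⟫-trans u∈g g∈

  module _ (two : ∃₂ λ t u → HasOrderP t × HasOrderP u × ¬ u ∈⟪ t ⟫) where
    private
      t₀ = proj₁ two
      t₀-order = proj₁ (proj₂ (proj₂ two))
      u₀-order = proj₁ (proj₂ (proj₂ (proj₂ two)))
      u₀∉⟪t₀⟫ = proj₂ (proj₂ (proj₂ (proj₂ two)))

    label : Carrier → Fin r
    label g with g ≟ ε
    -- The identity determines no subgroup of order p; its label is arbitrary, and `joined-label`
    -- excepts it.
    ... | yes _  = index t₀ t₀-order
    ... | no g≉ε = index _ (proj₂ (socle-power g≉ε))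

    joined-label : ∀ i g → Joined (rep i) g → label g ≡ i ⊎ g ≈ ε
    joined-label i g joined with g ≟ ε
    ... | yes g≈ε = inj₂ g≈ε
    ... | no g≉ε  = inj₁ (≡.trans (≡.sym (index-joined (rep-order i) (proj₂ (socle-power g≉ε))
      (⟪⟫-joined (⋆∈⟪⟫ (p ^ proj₁ (socle-power g≉ε))) joined))) (index-rep i))

    -- The exception is the identity rather than any universal element: a tuple that is excepted in
    -- every factor is then the identity of ∏ P, hence universal.
    escapes : Escapes (_≈ ε) r
    escapes n<r d = let i , unlabelled = missed n<r (label ∘ d) in
      rep i , λ j joined → [ (λ eq → contradiction eq (unlabelled j)) , id ]′ (joined-label i (d j) joined)

    representatives : Representatives r
    representatives = record
      { rep            = rep
      ; rep-injective  = λ {i} {j} eq → ≡.trans (≡.sym (index-rep i))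
          (≡.trans (index-joined (rep-order i) (rep-order j) (Joined-respʳ eq Joined-refl)) (index-rep j))
      -- Being joined to both t₀ and u₀ would give these the same subgroup of order p.
      ; rep-¬universal = λ i universal → u₀∉⟪t₀⟫ (index-injective u₀-order t₀-order
          (≡.trans (≡.sym (index-joined (rep-order i) u₀-order (universal _)))
                   (index-joined (rep-order i) t₀-order (universal _))))
      ; rep-covers     = covers
      }
      where
      covers : ∀ g → ∃ λ i → Joined (rep i) g
      covers g with g ≟ ε
      ... | yes g≈ε = index t₀ t₀-order , Joined-respʳ (sym g≈ε) (Joined-sym (ε-universal _))
      ... | no g≉ε  =
        let e , h-order = socle-power g≉ε
            i = index (p ^ e ⋆ g) h-order
        in i , g , ∈⟪⟫-trans (index-injective (rep-order i) h-order (index-rep i)) (⋆∈⟪⟫ (p ^ e)) , self∈⟪⟫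

-- Nilpotent factors

module _ {m} (P : Fin m → Group c ℓ) where
  private
    module P i = Group (P i)
    module ∏P = Group (∏ P)

  single : ∀ i → P.Carrier i → ∏P.Carrier
  single i g j with i Fin.≟ j
  ... | yes ≡.refl = g
  ... | no  _      = P.ε j

  single-≡ : ∀ i g → single i g i ≡ g
  single-≡ i g with i Fin.≟ i
  ... | yes ≡.refl = ≡.refl
  ... | no  i≢i    = contradiction ≡.refl i≢i

  -- Commutators are formed componentwise, so `single i h` tests the component `f i` against `h`.
  upperCentral-proj : ∀ i j {f} → upperCentral (∏ P) j f → upperCentral (P i) j (f i)
  upperCentral-proj i zero    (lift f≈ε) = lift (f≈ε i)
  upperCentral-proj i (suc j) {f} f∈ h =
    ≡.subst (λ g → upperCentral (P i) j (P._∙_ i (P._∙_ i (P._∙_ i (f i) g) (P._⁻¹ i (f i))) (P._⁻¹ i g)))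
      (single-≡ i h) (upperCentral-proj i j (f∈ (single i h)))

  nilpotent-proj : ∀ i → IsNilpotent (∏ P) → IsNilpotent (P i)
  nilpotent-proj i (j , central) = j , λ g →
    ≡.subst (upperCentral (P i) j) (single-≡ i g) (upperCentral-proj i j (central (single i g)))

  ⋆-∏ : ∀ n f i → P._≈_ i (Powers._⋆_ (∏ P) n f i) (Powers._⋆_ (P i) n (f i))
  ⋆-∏ n f i = ⋆-homo (∏ P) (P i) (λ f → f i) (P.refl i) (λ _ _ → P.refl i) n f

  ∈⟪⟫-∏ : ∀ {f g} i → Powers._∈⟪_⟫ (∏ P) f g → Powers._∈⟪_⟫ (P i) (f i) (g i)
  ∈⟪⟫-∏ {f} {g} i (n , f≈) = n , P.trans i (f≈ i) (⋆-∏ n g i)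

  Joined-∏ : ∀ {f g} i → Domination.Joined (∏ P) f g → Domination.Joined (P i) (f i) (g i)
  Joined-∏ i (w , f∈ , g∈) = w i , ∈⟪⟫-∏ i f∈ , ∈⟪⟫-∏ i g∈

  Escapes-∏ : ∀ {γ} → (∀ i → Domination.Escapes (P i) (λ g → P._≈_ i g (P.ε i)) γ) →
              Domination.Escapes (∏ P) (Domination.Universal (∏ P)) γ
  Escapes-∏ escapes n<γ d =
    (λ i → proj₁ (escapes i n<γ (λ j → d j i))) , λ j joined →
      λ f → Joined-respˡ (λ i → P.sym i (proj₂ (escapes i n<γ (λ j → d j i)) j (Joined-∏ i joined)))
                         (ε-universal f)
    where open Domination (∏ P)

module _ {m} (P : Fin (suc m) → Group c ℓ) where
  private
    module P i = Group (P i)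
    module P₀ where
      open Powers (P zero) public
      open Domination (P zero) public
    open Powers (∏ P) using (_∈⟪_⟫; ∈⟪⟫-resp)
    open Domination (∏ P) using (Representatives)

  cons : P.Carrier zero → (∀ i → P.Carrier (suc i)) → Group.Carrier (∏ P)
  cons g f zero    = g
  cons g f (suc i) = f i

  module _ {e M} (e⊥M : Coprime e M) (e-exponent : P₀.Exponent e)
           (M-exponent : ∀ i → Domination.Exponent (P (suc i)) M) where

    ∈⟪⟫-cons : ∀ {g w} → P₀._∈⟪_⟫ g w → ∀ f → cons g f ∈⟪ cons w f ⟫
    ∈⟪⟫-cons {w = w} (s , g≈) f =
      let n , n≡s , n≡1 = chinese-remainder e⊥M s 1 in n , λ
        { zero    → P.trans zero g≈ (P.trans zero (P.sym zero (P₀.⋆-mod n≡s (e-exponent w)))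
                      (P.sym zero (⋆-∏ P n (cons w f) zero)))
        ; (suc i) → let open Powers (P (suc i)) using (⋆-mod; 1⋆) in
            P.trans (suc i) (P.sym (suc i) (1⋆ (f i)))
              (P.trans (suc i) (P.sym (suc i) (⋆-mod n≡1 (M-exponent i (f i))))
                (P.sym (suc i) (⋆-∏ P n (cons w f) (suc i)))) }

    -- An exponent congruent to 0 modulo `M` erases the later factors; this joins a representative
    -- supported on the first factor to an arbitrary tuple.
    ∈⟪⟫-cons-ε : ∀ {g w} → P₀._∈⟪_⟫ g w → ∀ f → cons g (λ i → P.ε (suc i)) ∈⟪ cons w f ⟫
    ∈⟪⟫-cons-ε {w = w} (s , g≈) f =
      let n , n≡s , n≡0 = chinese-remainder e⊥M s 0 in n , λ
        { zero    → P.trans zero g≈ (P.trans zero (P.sym zero (P₀.⋆-mod n≡s (e-exponent w)))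
                      (P.sym zero (⋆-∏ P n (cons w f) zero)))
        ; (suc i) → let open Powers (P (suc i)) using (⋆-mod) in
            P.trans (suc i) (P.sym (suc i) (⋆-mod n≡0 (M-exponent i (f i))))
              (P.sym (suc i) (⋆-∏ P n (cons w f) (suc i))) }

    Representatives-∏ : ∀ {γ} → P₀.Representatives γ → Representatives γ
    Representatives-∏ reps = record
      { rep            = λ i → cons (rep i) (λ j → P.ε (suc j))
      ; rep-injective  = λ eq → rep-injective (eq zero)
      ; rep-¬universal = λ i universal → rep-¬universal i λ g →
          Joined-∏ P zero (universal (cons g (λ j → P.ε (suc j))))
      ; rep-covers     = λ f → let i , w , rep∈ , f₀∈ = rep-covers (f zero) in
          i , cons w (f ∘ suc) , ∈⟪⟫-cons-ε rep∈ (f ∘ suc) ,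
          ∈⟪⟫-resp (λ { zero → P.refl zero ; (suc j) → P.refl (suc j) }) (∈⟪⟫-cons f₀∈ (f ∘ suc))
      }
      where open P₀.Representatives reps

odd⇒coprime-2^ : ∀ {n} k → ¬ 2 ∣ n → Coprime n (2 ^ k)
odd⇒coprime-2^ k 2∤n = coprime-^ k (∤⇒coprime prime[2] 2∤n)

odd⇒nonZero : ∀ {n} → ¬ 2 ∣ n → NonZero n
odd⇒nonZero 2∤n = ≢-nonZero λ { ≡.refl → 2∤n (2 ∣0) }

distinct-primes⇒coprime : ∀ {p q} → Prime p → Prime q → ¬ p ≡ q → Coprime p q
distinct-primes⇒coprime {p} {q} p-prime q-prime p≢q = ∤⇒coprime q-prime λ q∣p →
  [ nonTrivial⇒≢1 {{prime⇒nonTrivial q-prime}} , (λ q≡p → p≢q (≡.sym q≡p)) ]′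
    (prime⇒irreducible p-prime q∣p)

module Nilpotent {m} (p : Fin (suc m) → ℕ) (P : Fin (suc m) → Group c ℓ)
                 {N} (order : HasOrder (∏ P) N) (2∤N : ¬ 2 ∣ N) (nilpotent : IsNilpotent (∏ P))
                 (sylowFactors : AreSylowFactors p P N) (¬cyclic : ∀ i → ¬ IsCyclic (P i))
                 (r : Fin (suc m) → ℕ) (card : ∀ i → HasCardinality (subgroupsOfOrder (P i) (p i)) (r i))
                 (r-sorted : ∀ i j → i Fin.≤ j → r i ≤ r j) where
  open AreSylowFactors sylowFactors

  private
    p-prime : ∀ i → Prime (p i)
    p-prime i = proj₁ (Equivalence.from (primeDivisors (p i)) (i , ≡.refl))

    2∤p : ∀ i → ¬ 2 ∣ p i
    2∤p i 2∣p = 2∤N (∣-trans 2∣p (proj₂ (Equivalence.from (primeDivisors (p i)) (i , ≡.refl))))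

    a : Fin (suc m) → ℕ
    a i = proj₁ (sylow i)

    P-order : ∀ i → HasOrder (P i) (p i ^ a i)
    P-order i = proj₁ (proj₂ (sylow i))

    module PP i = PrimePower (P i) (p-prime i) {a i} (P-order i)
    module Sub i = OrderPSubgroups (P i) (p-prime i) {a i} (P-order i) (card i)

    two : ∀ i → ∃₂ λ t u → PP.HasOrderP i t × PP.HasOrderP i u × ¬ Powers._∈⟪_⟫ (P i) u t
    two i = Noncyclic.two-subgroups (P i) (p-prime i) (2∤p i) {a i} (P-order i)
              (nilpotent-proj P i nilpotent) (¬cyclic i)

  -- `B` becomes Q for the first claim of (b) and Z × Q for the second, with the same `s`.
  module _ (B : Group c ℓ) (_≟ᴮ_ : Decidable₂ (Group._≈_ B))
           {f} .{{_ : NonZero f}} (f-exponent : Domination.Exponent B f) (N⊥f : Coprime N f)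
           {s} (1≤s : 1 ≤ s) (B-escapes : Domination.Escapes B (Domination.Universal B) s)
           (B-representatives : Domination.Representatives B s) where
    private
      instance
        Nf≢0 : NonZero (N * f)
        Nf≢0 = m*n≢0 N f {{odd⇒nonZero 2∤N}}

      1≤r : 1 ≤ r zero
      1≤r = let t , _ , t-order , _ = two zero in ≤-trans (s≤s z≤n) (Fin.toℕ<n (Sub.index zero t t-order))

      G = group (∏ P) B

      N-exponent : Domination.Exponent (∏ P) N
      N-exponent = Lagrange.order-⋆ (∏ P) order

      representatives-∏ : Domination.Representatives (∏ P) (r zero)
      representatives-∏ =
        let M , p^a⊥M , ∣M = coprime-multiple (p zero ^ a zero) (λ i → p (suc i) ^ a (suc i)) λ i →
              coprime-^ (a (suc i)) (Coprimality.sym (coprime-^ (a zero)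
                (distinct-primes⇒coprime (p-prime (suc i)) (p-prime zero) λ eq → contradiction (distinct eq) λ ())))
        in Representatives-∏ P p^a⊥M (PP.exponent zero)
             (λ i g → Powers.∣-⋆-vanishes (P (suc i)) (∣M i) (PP.exponent (suc i) g))
             (Sub.representatives zero (two zero))

      -- The smaller bound is realized in its own factor: r₁ in the first Sylow factor, s in B.
      representatives : Domination.Representatives G (r zero ⊓ s)
      representatives with ≤-total (r zero) s
      ... | inj₁ r≤s = ≡.subst (Domination.Representatives G) (≡.sym (m≤n⇒m⊓n≡m r≤s))
                         (Product.Representatives-×ˡ (∏ P) B N⊥f N-exponent f-exponent representatives-∏)
      ... | inj₂ s≤r = ≡.subst (Domination.Representatives G) (≡.sym (m≥n⇒m⊓n≡n s≤r))
                         (Product.Representatives-×ʳ (∏ P) B N⊥f N-exponent f-exponent B-representatives)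

      -- As r₁ is the least of the r i, every Sylow factor escapes at this bound.
      escapes : Domination.Escapes G (Domination.Universal G) (r zero ⊓ s)
      escapes = Product.Escapes-× (∏ P) B N⊥f N-exponent f-exponent
        (Escapes-∏ P λ i → Domination.Escapes-anti (P i) {T = λ g → Group._≈_ (P i) g (Group.ε (P i))}
          (≤-trans (m⊓n≤m (r zero) s) (r-sorted zero i z≤n)) (Sub.escapes i (two i)))
        (Domination.Escapes-anti B {T = Domination.Universal B} (m⊓n≤n (r zero) s) B-escapes)

    dominationNumber : IsDominationNumber (properEnhancedPowerGraph (group (∏ P) B)) (r zero ⊓ s)
    dominationNumber = Domination.isDominationNumber G
      (×-decidable (Finite._≟_ (Group.setoid (∏ P)) order) _≟ᴮ_)
      {N * f} (Product.Exponent-× (∏ P) B {N} {f} N-exponent f-exponent)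
      (⊓-glb 1≤r 1≤s) representatives escapes

theorem2p5 :
    ∀ {c ℓ} (k : ℕ) → 3 ≤ k →
    (Q : Group c ℓ) → IsGeneralizedQuaternion Q k →
    (n : ℕ) → 1 ≤ n → ¬ (2 ∣ n) →
    (Z : Group c ℓ) → IsCyclic Z → HasOrder Z n →
    ( IsDominationNumber (properEnhancedPowerGraph Q) (2 ^ (k ∸ 2) + 1)
    × IsDominationNumber (properEnhancedPowerGraph (group Z Q)) (2 ^ (k ∸ 2) + 1) )
    ×
    ( ∀ (m : ℕ) (p : Fin (suc m) → ℕ) (P : Fin (suc m) → Group c ℓ) (N : ℕ) →
      HasOrder (∏ P) N → ¬ (2 ∣ N) → IsNilpotent (∏ P) →
      AreSylowFactors p P N →
      (∀ i → ¬ IsCyclic (P i)) →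
      (r : Fin (suc m) → ℕ) →
      (∀ i → HasCardinality (subgroupsOfOrder (P i) (p i)) (r i)) →
      (∀ i j → i Fin.≤ j → r i ≤ r j) →
      IsDominationNumber (properEnhancedPowerGraph (group (∏ P) Q)) (r zero ⊓ (2 ^ (k ∸ 2) + 1))
      × ( gcd N n ≡ 1 →
          IsDominationNumber (properEnhancedPowerGraph (group (∏ P) (group Z Q)))
            (r zero ⊓ (2 ^ (k ∸ 2) + 1)) ) )
theorem2p5 (suc (suc (suc k′))) (s≤s (s≤s (s≤s z≤n))) Q isQuaternion n 1≤n 2∤n Z Z-cyclic Z-order =
  ( Domination.isDominationNumber Q _≟Q_ Q.exponent 1≤s Q-representatives Q-escapes
  , Domination.isDominationNumber (group Z Q) _≟ZQ_ ZQ-exponent 1≤s ZQ-representatives ZQ-escapes ) ,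
  λ m p P N order 2∤N nilpotent sylowFactors ¬cyclic r card r-sorted →
    let open Nilpotent p P order 2∤N nilpotent sylowFactors ¬cyclic r card r-sorted
        N⊥2^k = odd⇒coprime-2^ (3 + k′) 2∤N
    in dominationNumber Q _≟Q_ Q.exponent N⊥2^k 1≤s Q-escapes Q-representatives
     , λ gcd≡1 → dominationNumber (group Z Q) _≟ZQ_ ZQ-exponent (coprime-* (gcd≡1⇒coprime gcd≡1) N⊥2^k)
                   1≤s ZQ-escapes ZQ-representatives
  where
  module Q = Quaternion Q k′ isQuaternion
  open Q using (h; 2n≢0)

  instance
    n≢0 : NonZero n
    n≢0 = >-nonZero 1≤n
    n2^k≢0 : NonZero (n * 2 ^ (3 + k′))
    n2^k≢0 = m*n≢0 n (2 ^ (3 + k′))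

  s : ℕ
  s = h + 1

  1≤s : 1 ≤ s
  1≤s = m≤n+m 1 h

  _≟Q_ = Finite._≟_ (Group.setoid Q) (IsGeneralizedQuaternion.order isQuaternion)
  _≟ZQ_ = ×-decidable (Finite._≟_ (Group.setoid Z) Z-order) _≟Q_

  n-exponent : Domination.Exponent Z n
  n-exponent = Lagrange.order-⋆ Z Z-order

  ZQ-exponent : Domination.Exponent (group Z Q) (n * 2 ^ (3 + k′))
  ZQ-exponent = Product.Exponent-× Z Q {n} {2 ^ (3 + k′)} n-exponent Q.exponent

  Q-representatives : Domination.Representatives Q s
  Q-representatives = ≡.subst (Domination.Representatives Q) (+-comm 1 h) Q.representatives

  Q-escapes : Domination.Escapes Q (Domination.Universal Q) s
  Q-escapes = Domination.Escapes-anti Q {T = Domination.Universal Q} (≤-reflexive (+-comm h 1)) Q.escapes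

  -- All elements of a cyclic group are universal, so any witness will do.
  Z-escapes : Domination.Escapes Z (Domination.Universal Z) s
  Z-escapes _ _ = Group.ε Z , λ _ _ → cyclic⇒universal Z n-exponent Z-cyclic _

  ZQ-representatives : Domination.Representatives (group Z Q) s
  ZQ-representatives = Product.Representatives-×ʳ Z Q (odd⇒coprime-2^ (3 + k′) 2∤n) n-exponent Q.exponent
                         Q-representatives

  ZQ-escapes : Domination.Escapes (group Z Q) (Domination.Universal (group Z Q)) s
  ZQ-escapes = Product.Escapes-× Z Q (odd⇒coprime-2^ (3 + k′) 2∤n) n-exponent Q.exponent Z-escapes Q-escapes
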